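{- (i) For every fixed integer dimension $d>16$, every online algorithm for vector packing (VP) in dimension $d$ has asymptotic competitive ratio at least $$\frac{d-1}{8(\log_2 d)^3}.$$ (ii) There is an integer $d_0$ such that for every fixed integer $d\ge d_0$, every online algorithm for VP in dimension $d$ has asymptotic competitive ratio at least $$\frac{d}{2^{11}\cdot(\log_2 d)^2}.$$
   Context: Vector packing (VP) in dimension $d$: an item is a non-zero vector in $[0,1]^d$ with rational components. A packing of a finite collection of items is a partition of it into subsets called bins such that the vector sum of the items in every bin does not exceed $1$ in any component. For an input $L$ (a finite sequence of items), $OPT(L)$ is the minimum number of bins in a packing of the items of $L$. An online algorithm $A$ receives the items of $L$ one by one and packs each item irrevocably, before the next item is presented, into a new (empty) bin or into an already non-empty bin, keeping the packing feasible; its decisions are deterministic functions of the items presented so far (the total length of the input is not known to it). $A(L)$ denotes the number of bins $A$ uses for $L$. The asymptotic competitive ratio of $A$ is $$\lim_{K\to\infty}\ \sup_{L:\,OPT(L)\ge K}\ \frac{A(L)}{OPT(L)}\in[1,\infty].$$ The dimension $d$ is a fixed constant, known to the algorithm. -}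

module Defs where

open import Data.Bool using (if_then_else_)
open import Data.Fin using (Fin; toℕ; suc; _≟_)
import Data.Integer as ℤ
open import Data.List using (List; _∷_; length; lookup)
open import Data.Nat as ℕ using (ℕ; zero; suc)
open import Data.Product using (Σ-syntax; ∃; ∃₂; _×_; _,_)
open import Data.Rational as ℚ using (ℚ; 0ℚ; 1ℚ; ↥_; ↧ₙ_)
open import Data.Rational.Properties using (+-0-commutativeMonoid)
open import Data.Sum using (_⊎_)
open import Data.Vec as Vec using (Vec)
open import Function.Definitions using (StrictlySurjective)
open import Level using (0ℓ)
open import Relation.Binary.PropositionalEquality using (_≡_; _≢_)
open import Relation.Nullary using (does)
open import Relation.Unary using (Pred; _⊆_; ⋃)

open import Algebra.Properties.CommutativeMonoid.Sum +-0-commutativeMonoid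
  using (sum)

private variable
  d : ℕ

ℕ→ℚ : ℕ → ℚ
ℕ→ℚ n = ℤ.+ n ℚ./ 1

------------------------------------------------------------------------
-- Real numbers

-- A real x is given by the rationals strictly below and strictly above it.
-- The operations assume positive arguments.
record Cut : Set₁ where
  constructor cut
  field
    below : Pred ℚ 0ℓ
    above : Pred ℚ 0ℓ

open Cut public

infixl 7 _*_ _/_
infixr 8 _^_

fromℕ : ℕ → Cut
fromℕ n = cut (ℚ._< ℕ→ℚ n) (ℕ→ℚ n ℚ.<_)

_*_ : Cut → Cut → Cut
below (x * y) q = ∃₂ λ a b →
  0ℚ ℚ.< a × below x a × 0ℚ ℚ.< b × below y b × q ℚ.≤ a ℚ.* b
above (x * y) q = ∃₂ λ a b →
  above x a × above y b × a ℚ.* b ℚ.≤ q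

_/_ : Cut → Cut → Cut
below (x / y) q = ∃₂ λ a b →
  below x a × above y b × q ℚ.* b ℚ.≤ a
above (x / y) q = ∃₂ λ a b →
  above x a × 0ℚ ℚ.< b × below y b × a ℚ.≤ q ℚ.* b

_^_ : Cut → ℕ → Cut
x ^ zero  = fromℕ 1
x ^ suc n = x * x ^ n

-- For n ≥ 1, so that log₂ n ≥ 0.  For q = a / b ≥ 0 (b > 0),
-- q < log₂ n iff 2ᵃ < nᵇ, and similarly above.
log₂ : ℕ → Cut
below (log₂ n) q =
  q ℚ.< 0ℚ ⊎ 2 ℕ.^ ℤ.∣ ↥ q ∣ ℕ.< n ℕ.^ (↧ₙ q)
above (log₂ n) q =
  0ℚ ℚ.< q × n ℕ.^ (↧ₙ q) ℕ.< 2 ℕ.^ ℤ.∣ ↥ q ∣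

-- An extended real, given by the rationals strictly below it; the empty
-- predicate is -∞ and the everywhere-true one is ∞.
LowerCut : Set₁
LowerCut = Pred ℚ 0ℓ

sup : {I : Set} → (I → LowerCut) → LowerCut
sup {I} f = ⋃ I f

-- The limit inferior, which is the limit whenever that exists; it does for
-- the antitone sequence this is used for.
lim : (ℕ → LowerCut) → LowerCut
lim s q = ∃ λ r → q ℚ.< r × ∃ λ N → ∀ K → N ℕ.≤ K → s K r

infix 4 _≥ᴿ_

_≥ᴿ_ : LowerCut → Cut → Set
x ≥ᴿ c = below c ⊆ x

------------------------------------------------------------------------
-- Vector packing

record Item (d : ℕ) : Set where
  constructor item
  field
    vec     : Vec ℚ d
    0≤vec   : ∀ j → 0ℚ ℚ.≤ Vec.lookup vec j
    vec≤1   : ∀ j → Vec.lookup vec j ℚ.≤ 1ℚ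
    nonZero : vec ≢ Vec.replicate d 0ℚ

open Item public

-- Newest item first: x ∷ L is the input L followed by the item x.
Input : ℕ → Set
Input d = List (Item d)

record Packing (L : Input d) : Set where
  field
    #bins : ℕ
    bin   : Fin (length L) → Fin #bins

  load : Fin #bins → Fin d → ℚ
  load b j = sum λ i →
    if does (bin i ≟ b) then Vec.lookup (vec (lookup L i)) j else 0ℚ

  field
    nonEmpty : StrictlySurjective _≡_ bin
    feasible : ∀ b j → load b j ℚ.≤ 1ℚ

open Packing public

IsOPT : Input d → ℕ → Set
IsOPT L m =
  (Σ[ P ∈ Packing L ] #bins P ≡ m) × (∀ (P : Packing L) → m ℕ.≤ #bins P)

-- Bins are numbered in the order in which they are opened, so an item never
-- changes its bin number.  Since the packing of x ∷ L has no empty bins, x is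
-- put either into a bin used for L or into the single next new bin.
record OnlineAlgorithm (d : ℕ) : Set where
  field
    pack        : (L : Input d) → Packing L
    irrevocable : ∀ x L i →
      toℕ (bin (pack (x ∷ L)) (suc i)) ≡ toℕ (bin (pack L) i)

open OnlineAlgorithm public

cost : OnlineAlgorithm d → Input d → ℕ
cost A L = #bins (pack A L)

-- The quotient m / n.  Only the empty input has n = 0, and then m = 0 too;
-- the result is -∞, so that input does not contribute to a supremum.
ratio : ℕ → ℕ → LowerCut
ratio m n q = q ℚ.* ℕ→ℚ n ℚ.< ℕ→ℚ m

asymptoticRatio : OnlineAlgorithm d → LowerCut
asymptoticRatio {d} A = lim λ K →
  sup {Σ[ L ∈ Input d ] Σ[ opt ∈ ℕ ] IsOPT L opt × K ℕ.≤ opt}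
    λ (L , opt , _) → ratio (cost A L) opt

-- Adversary after Halldórsson and Szegedy.  The coordinates are the vertices
-- of a graph; vertex τ arrives as N equal items, of weight 1 in coordinate τ
-- and 1/d in the coordinates of its earlier neighbours.  So a bin holds an
-- independent set, and the algorithm plays online fractional colouring.
--
-- Let h = ⌊log₂ d⌋ + 1 and m = 2h.  A vertex has a label x in {0,1}ᵐ and, fixed
-- only after its items are packed, a colour (i , xᵢ); its neighbours are the
-- earlier vertices of a colour (j , v) with v ≠ xⱼ.  The colour classes are
-- independent, so N copies of each of the 2m classes give OPT ≤ 2mN.
--
-- A bin holding k colours accepts a random label with probability at most 2⁻ᵏ,
-- so some label is accepted by at most 2⁻ʰ C of the C bins among those holding
-- at least h colours.  The other copies lie in bins that miss at least half of
-- the m possible indices, so some i gives half of these bins a new colour.  As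
-- each bin is counted for at most h colours, d ≤ 2ʰ vertices lead to
-- d N ≤ (2h + 1) C, and hence C / OPT ≥ d / (4h (2h + 1)).

module Submission where

open import Data.Bool as Bool using (Bool; true; false; if_then_else_)
open import Data.Fin as Fin using (Fin; zero; suc; toℕ; fromℕ<; combine; punchOut; inject≤)
open import Data.Fin.Properties as Finₚ using (toℕ<n; toℕ-injective)
open import Data.Integer as ℤ using ()
import Data.Integer.Properties as ℤₚ
open import Data.List as List using (List; []; _∷_; length; lookup)
open import Data.List.Relation.Unary.All as All using (All; []; _∷_)
open import Data.List.Relation.Unary.AllPairs using ([]; _∷_)
open import Data.List.Relation.Unary.Any using (here; there)
open import Data.List.Relation.Unary.Unique.Propositional using (Unique)
open import Data.Maybe using (Maybe; just; nothing)
open import Data.Maybe.Properties using (just-injective)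
open import Data.Nat as ℕ using (ℕ; zero; suc; _∸_; _⊓_; _≤_; _<_; z≤n; s≤s; NonZero)
open import Data.List.Membership.DecPropositional ℕ._≟_ using (_∈_; _∈?_)
open import Data.Nat.Properties as ℕₚ
open import Data.Nat.Tactic.RingSolver using (solve-∀)
open import Data.Product using (∃; ∃₂; _×_; _,_; proj₁; proj₂)
open import Data.Product.Properties using (≡-dec)
open import Data.Rational as ℚ using (ℚ; 0ℚ; 1ℚ)
open import Data.Rational.Properties as ℚₚ using ()
import Data.Rational.Unnormalised as ℚᵘ
import Data.Rational.Unnormalised.Properties as ℚᵘₚ
open import Data.Sum using (_⊎_; inj₁; inj₂; [_,_]′)
open import Data.Vec as Vec using (Vec; []; _∷_; _[_]≔_)
open import Data.Vec.Properties as Vecₚ using ()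
open import Function using (_∘_; mk⇔; Inverse)
open import Relation.Binary.Definitions using (DecidableEquality)
open import Relation.Binary.PropositionalEquality
open import Relation.Nullary using (Dec; yes; no; does; ¬_; contradiction)
open import Relation.Nullary.Decidable using (map′; decidable-stable; dec-true; dec-false; does-⇔)

open import Defs hiding (_*_; _/_; _^_)

-- Sums of naturals over initial segments, and counting by indicators

module FiniteSums where

  open import Data.Nat using (_+_; _*_)
  open import Algebra.Properties.CommutativeMonoid.Sum +-0-commutativeMonoid
    using (sum; ∑-distrib-+)
  open import Algebra.Properties.CommutativeSemigroup +-commutativeSemigroup using (interchange)

  ∑ : ℕ → (ℕ → ℕ) → ℕ
  ∑ zero    f = 0
  ∑ (suc n) f = f n + ∑ n f

  ∑-+ : ∀ n f g → ∑ n (λ b → f b + g b) ≡ ∑ n f + ∑ n g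
  ∑-+ zero    f g = refl
  ∑-+ (suc n) f g = trans (cong (f n + g n +_) (∑-+ n f g))
    (interchange (f n) (g n) (∑ n f) (∑ n g))

  ∑-* : ∀ n c f → ∑ n (λ b → c * f b) ≡ c * ∑ n f
  ∑-* zero    c f = sym (*-zeroʳ c)
  ∑-* (suc n) c f = trans (cong (c * f n +_) (∑-* n c f))
    (sym (*-distribˡ-+ c (f n) (∑ n f)))

  ∑-cong : ∀ n {f g} → (∀ b → f b ≡ g b) → ∑ n f ≡ ∑ n g
  ∑-cong zero    f≡g = refl
  ∑-cong (suc n) f≡g = cong₂ _+_ (f≡g n) (∑-cong n f≡g)

  ∑-mono : ∀ n {f g} → (∀ b → f b ≤ g b) → ∑ n f ≤ ∑ n g
  ∑-mono zero    f≤g = z≤n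
  ∑-mono (suc n) f≤g = +-mono-≤ (f≤g n) (∑-mono n f≤g)

  ∑-≤ : ∀ n {f c} → (∀ b → f b ≤ c) → ∑ n f ≤ n * c
  ∑-≤ zero    f≤c = z≤n
  ∑-≤ (suc n) f≤c = +-mono-≤ (f≤c n) (∑-≤ n f≤c)

  ∑-monoˡ : ∀ {n n′} f → n ≤ n′ → ∑ n f ≤ ∑ n′ f
  ∑-monoˡ f n≤n′ = go (≤⇒≤′ n≤n′)
    where
    go : ∀ {n n′} → n ℕ.≤′ n′ → ∑ n f ≤ ∑ n′ f
    go ℕ.≤′-refl       = ≤-refl
    go (ℕ.≤′-step n≤m) = ≤-trans (go n≤m) (m≤n+m _ _)

  ∑-truncate : ∀ {n n′} f → n ≤ n′ → (∀ b → n ≤ b → f b ≡ 0) → ∑ n′ f ≤ ∑ n f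
  ∑-truncate {n} f n≤n′ f≡0 = go (≤⇒≤′ n≤n′)
    where
    go : ∀ {n′} → n ℕ.≤′ n′ → ∑ n′ f ≤ ∑ n f
    go ℕ.≤′-refl           = ≤-refl
    go (ℕ.≤′-step {m} n≤m) =
      ≤-trans (≤-reflexive (cong (_+ ∑ m f) (f≡0 m (≤′⇒≤ n≤m)))) (go n≤m)

  sum-∑ : ∀ {m} n (f : Fin m → ℕ → ℕ) →
    sum (λ i → ∑ n (f i)) ≡ ∑ n (λ b → sum (λ i → f i b))
  sum-∑ {zero}  zero    f = refl
  sum-∑ {suc m} zero    f = sum-∑ {m} zero (λ i → f (suc i))
  sum-∑         (suc n) f = trans
    (∑-distrib-+ (λ i → f i n) (λ i → ∑ n (f i)))
    (cong (sum (λ i → f i n) +_) (sum-∑ n f))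

  some-≥-mean : ∀ {m} (f : Fin (suc m) → ℕ) → ∃ λ i → sum f ≤ suc m * f i
  some-≥-mean {zero}  f = zero , ≤-refl
  some-≥-mean {suc m} f with some-≥-mean (f ∘ suc)
  ... | i , sum≤ with ≤-total (f zero) (f (suc i))
  ... | inj₁ f₀≤fᵢ = suc i , +-mono-≤ f₀≤fᵢ sum≤
  ... | inj₂ fᵢ≤f₀ = zero ,
    +-monoʳ-≤ (f zero) (≤-trans sum≤ (*-monoʳ-≤ (suc m) fᵢ≤f₀))

  ⟦_⟧ : ∀ {A : Set} → Dec A → ℕ
  ⟦ yes _ ⟧ = 1
  ⟦ no _  ⟧ = 0

  ⟦⟧-yes : ∀ {A : Set} (a? : Dec A) → A → ⟦ a? ⟧ ≡ 1
  ⟦⟧-yes (yes _) a = refl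
  ⟦⟧-yes (no ¬a) a = contradiction a ¬a

  ⟦⟧-no : ∀ {A : Set} (a? : Dec A) → ¬ A → ⟦ a? ⟧ ≡ 0
  ⟦⟧-no (yes a) ¬a = contradiction a ¬a
  ⟦⟧-no (no _)  ¬a = refl

  ∑-⟦≡⟧ : ∀ {b} n → b < n → 1 ≤ ∑ n (λ c → ⟦ c ℕ.≟ b ⟧)
  ∑-⟦≡⟧ {b} (suc n) (s≤s b≤n) with n ℕ.≟ b
  ... | yes _  = s≤s z≤n
  ... | no n≢b = ∑-⟦≡⟧ n (≤∧≢⇒< b≤n (n≢b ∘ sym))

  -- Distinctness keeps the indicators of the single elements from overlapping, so their sum stays
  -- below the indicator of membership.
  length≤∑ : ∀ {n bs} → Unique bs → All (_< n) bs →
    List.length bs ≤ ∑ n (λ b → ⟦ b ∈? bs ⟧)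
  length≤∑ [] [] = z≤n
  length≤∑ {n} {b₀ ∷ bs} (b₀∉bs ∷ bs!) (b₀<n ∷ bs<n) = begin
    1 + List.length bs
      ≤⟨ +-mono-≤ (∑-⟦≡⟧ n b₀<n) (length≤∑ bs! bs<n) ⟩
    ∑ n (λ b → ⟦ b ℕ.≟ b₀ ⟧) + ∑ n (λ b → ⟦ b ∈? bs ⟧)
      ≡⟨ ∑-+ n _ _ ⟨
    ∑ n (λ b → ⟦ b ℕ.≟ b₀ ⟧ + ⟦ b ∈? bs ⟧)
      ≤⟨ ∑-mono n pointwise ⟩
    ∑ n (λ b → ⟦ b ∈? (b₀ ∷ bs) ⟧) ∎
    where
    open ≤-Reasoning
    pointwise : ∀ b → ⟦ b ℕ.≟ b₀ ⟧ + ⟦ b ∈? bs ⟧ ≤ ⟦ b ∈? (b₀ ∷ bs) ⟧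
    pointwise b with b ℕ.≟ b₀ | b ∈? bs
    ... | yes refl | yes b∈bs = contradiction refl (All.lookup b₀∉bs b∈bs)
    ... | yes refl | no _     = ≤-refl
    ... | no _     | yes _    = ≤-refl
    ... | no _     | no _     = z≤n

open FiniteSums

-- Partial 0/1 vectors and the total vectors extending them

module PartialVectors where

  open import Data.Nat using (_+_; _*_; _^_)
  open import Algebra.Properties.CommutativeSemigroup *-commutativeSemigroup using (x∙yz≈y∙xz)
  open import Algebra.Properties.CommutativeMonoid.Sum +-0-commutativeMonoid
    using (sum)

  Partial : ℕ → Set
  Partial = Vec (Maybe Bool)

  vacant : Maybe Bool → ℕ
  vacant nothing  = 1
  vacant (just _) = 0

  filled : ∀ {m} → Partial m → ℕ
  filled []             = 0
  filled (nothing ∷ p) = filled p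
  filled (just _  ∷ p) = suc (filled p)

  filled+vacant : ∀ {m} (p : Partial m) →
    filled p + sum (λ i → vacant (Vec.lookup p i)) ≡ m
  filled+vacant []            = refl
  filled+vacant (nothing ∷ p) = trans (+-suc (filled p) _) (cong suc (filled+vacant p))
  filled+vacant (just _ ∷ p)  = cong suc (filled+vacant p)

  filled-update : ∀ {m} (p : Partial m) i v →
    filled (p [ i ]≔ just v) ≡ filled p + vacant (Vec.lookup p i)
  filled-update (nothing ∷ p) zero    v = sym (+-comm (filled p) 1)
  filled-update (just _ ∷ p)  zero    v = sym (+-identityʳ _)
  filled-update (nothing ∷ p) (suc i) v = filled-update p i v
  filled-update (just _ ∷ p)  (suc i) v = cong suc (filled-update p i v)

  filled>0 : ∀ {m} (p : Partial m) → 0 < filled p →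
    ∃₂ λ i v → Vec.lookup p i ≡ just v
  filled>0 (nothing ∷ p) f>0 =
    let i , v , eq = filled>0 p f>0 in suc i , v , eq
  filled>0 (just v ∷ p)  f>0 = zero , v , refl

  agree₁ : Maybe Bool → Bool → ℕ
  agree₁ nothing      _     = 1
  agree₁ (just true)  true  = 1
  agree₁ (just false) false = 1
  agree₁ (just _)     _     = 0

  -- The indicator that `x` extends `p`, kept as a product so that it can be averaged one coordinate
  -- at a time.
  agree : ∀ {m} → Partial m → Vec Bool m → ℕ
  agree []      []      = 1
  agree (u ∷ p) (y ∷ x) = agree₁ u y * agree p x

  agree-extension : ∀ {m} (p : Partial m) (x : Vec Bool m) →
    (∀ i v → Vec.lookup p i ≡ just v → Vec.lookup x i ≡ v) → agree p x ≡ 1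
  agree-extension []      []      ext = refl
  agree-extension (u ∷ p) (y ∷ x) ext = cong₂ _*_ (head u (ext zero))
    (agree-extension p x (ext ∘ suc))
    where
    head : ∀ u → (∀ v → u ≡ just v → y ≡ v) → agree₁ u y ≡ 1
    head nothing      _ = refl
    head (just true)  e rewrite e true refl = refl
    head (just false) e rewrite e false refl = refl

  -- This is the sum of `agree p x` over all `x`: the sum of a product over coordinates factors.
  extensions : ∀ {m} → Partial m → ℕ
  extensions []      = 1
  extensions (u ∷ p) = (agree₁ u true + agree₁ u false) * extensions p

  -- A vacant entry contributes a factor 2 to `extensions` and a filled one a factor 1, which
  -- `2 ^ filled p` makes up for.
  2^filled*extensions : ∀ {m} (p : Partial m) → 2 ^ filled p * extensions p ≡ 2 ^ m
  2^filled*extensions []      = refl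
  2^filled*extensions {suc m} (nothing ∷ p) = begin
    2 ^ filled p * (2 * extensions p) ≡⟨ x∙yz≈y∙xz (2 ^ filled p) 2 _ ⟩
    2 * (2 ^ filled p * extensions p) ≡⟨ cong (2 *_) (2^filled*extensions p) ⟩
    2 * 2 ^ m                         ∎
    where
    open ≡-Reasoning
  2^filled*extensions {suc m} (just v ∷ p) = begin
    2 * 2 ^ filled p * ((agree₁ (just v) true + agree₁ (just v) false) * extensions p)
      ≡⟨ cong (λ k → 2 * 2 ^ filled p * (k * extensions p)) (one v) ⟩
    2 * 2 ^ filled p * (1 * extensions p)
      ≡⟨ lem (2 ^ filled p) (extensions p) ⟩
    2 * (2 ^ filled p * extensions p)  ≡⟨ cong (2 *_) (2^filled*extensions p) ⟩
    2 * 2 ^ m                          ∎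
    where
    open ≡-Reasoning
    one : ∀ v → agree₁ (just v) true + agree₁ (just v) false ≡ 1
    one true  = refl
    one false = refl
    lem : ∀ a c → 2 * a * (1 * c) ≡ 2 * (a * c)
    lem = solve-∀

  -- The method of conditional expectations, fixing one coordinate at a time.
  few-agree : ∀ {m} C (w : ℕ → ℕ) (P : ℕ → Partial m) → ∃ λ x →
    2 ^ m * ∑ C (λ b → w b * agree (P b) x) ≤ ∑ C (λ b → w b * extensions (P b))
  few-agree {zero} C w P = [] , ≤-trans (≤-reflexive (*-identityˡ _))
    (∑-mono C λ b → *-monoʳ-≤ (w b) (empty (P b)))
    where
    empty : (p : Partial 0) → agree p [] ≤ extensions p
    empty [] = ≤-refl
  few-agree {suc m} C w P = choose (≤-total (S true) (S false))
    where
    open ≤-Reasoning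
    -- Once the first coordinate is fixed to `y`, its factor of `agree` moves into the weight, and
    -- the induction hypothesis applies to the tails.
    W : Bool → ℕ → ℕ
    W y b = w b * agree₁ (Vec.head (P b)) y
    S : Bool → ℕ
    S y = ∑ C (λ b → W y b * extensions (Vec.tail (P b)))
    split : S true + S false ≡ ∑ C (λ b → w b * extensions (P b))
    split = trans (sym (∑-+ C _ _)) (∑-cong C λ b → pointwise (w b) (P b))
      where
      distrib : ∀ k a c e → k * a * e + k * c * e ≡ k * ((a + c) * e)
      distrib = solve-∀
      pointwise : ∀ k (p : Partial (suc m)) →
        k * agree₁ (Vec.head p) true * extensions (Vec.tail p)
        + k * agree₁ (Vec.head p) false * extensions (Vec.tail p) ≡ k * extensions p
      pointwise k (u ∷ p) = distrib k (agree₁ u true) (agree₁ u false) (extensions p)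
    -- The hypothesis says that the branch `y` is at most average, as the smaller of the two
    -- branches is.
    extend : ∀ y → 2 * S y ≤ S true + S false → ∃ λ x →
      2 ^ suc m * ∑ C (λ b → w b * agree (P b) x) ≤ ∑ C (λ b → w b * extensions (P b))
    extend y 2Sy≤S with few-agree C (W y) (Vec.tail ∘ P)
    ... | x , bound = y ∷ x , (begin
      2 ^ suc m * ∑ C (λ b → w b * agree (P b) (y ∷ x))
        ≡⟨ cong (2 ^ suc m *_) (∑-cong C λ b → pointwise (w b) (P b)) ⟩
      2 * 2 ^ m * ∑ C (λ b → W y b * agree (Vec.tail (P b)) x)
        ≡⟨ *-assoc 2 (2 ^ m) _ ⟩
      2 * (2 ^ m * ∑ C (λ b → W y b * agree (Vec.tail (P b)) x))
        ≤⟨ *-monoʳ-≤ 2 bound ⟩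
      2 * S y
        ≤⟨ 2Sy≤S ⟩
      S true + S false
        ≡⟨ split ⟩
      ∑ C (λ b → w b * extensions (P b)) ∎)
      where
      pointwise : ∀ k (p : Partial (suc m)) →
        k * agree p (y ∷ x) ≡ k * agree₁ (Vec.head p) y * agree (Vec.tail p) x
      pointwise k (u ∷ p) = sym (*-assoc k (agree₁ u y) (agree p x))
    double : ∀ {a b} → a ≤ b → 2 * a ≤ a + b
    double {a} a≤b = +-monoʳ-≤ a (≤-trans (≤-reflexive (+-identityʳ a)) a≤b)
    choose : S true ≤ S false ⊎ S false ≤ S true → ∃ λ x →
      2 ^ suc m * ∑ C (λ b → w b * agree (P b) x) ≤ ∑ C (λ b → w b * extensions (P b))
    choose = λ where
      (inj₁ t≤f) → extend true (double t≤f)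
      (inj₂ f≤t) → extend false (≤-trans (double f≤t) (≤-reflexive (+-comm (S false) (S true))))

  -- A random 0/1 vector extends a partial vector with at least h entries with
  -- probability at most 2 ^ - h.
  few-full-agree : ∀ {m} h C (P : ℕ → Partial m) → ∃ λ x →
    2 ^ h * ∑ C (λ b → ⟦ h ℕ.≤? filled (P b) ⟧ * agree (P b) x) ≤ C
  -- The weight selects the vectors with at least `h` filled entries; each of these has at most 2 ^
  -- (m - h) extensions.
  few-full-agree {m} h C P with few-agree C (λ b → ⟦ h ℕ.≤? filled (P b) ⟧) P
  ... | x , bound = x , *-cancelˡ-≤ (2 ^ m) {{m^n≢0 2 m}} (begin
    2 ^ m * (2 ^ h * A)  ≡⟨ x∙yz≈y∙xz (2 ^ m) (2 ^ h) A ⟩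
    2 ^ h * (2 ^ m * A)  ≤⟨ *-monoʳ-≤ (2 ^ h) bound ⟩
    2 ^ h * ∑ C (λ b → ⟦ h ℕ.≤? filled (P b) ⟧ * extensions (P b))
                         ≡⟨ ∑-* C (2 ^ h) _ ⟨
    ∑ C (λ b → 2 ^ h * (⟦ h ℕ.≤? filled (P b) ⟧ * extensions (P b)))
                         ≤⟨ ∑-≤ C (λ b → pointwise (P b)) ⟩
    C * 2 ^ m            ≡⟨ *-comm C (2 ^ m) ⟩
    2 ^ m * C            ∎)
    where
    open ≤-Reasoning
    A = ∑ C (λ b → ⟦ h ℕ.≤? filled (P b) ⟧ * agree (P b) x)
    pointwise : (p : Partial m) → 2 ^ h * (⟦ h ℕ.≤? filled p ⟧ * extensions p) ≤ 2 ^ m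
    pointwise p with h ℕ.≤? filled p
    ... | no  _   = ≤-trans (≤-reflexive (*-zeroʳ (2 ^ h))) z≤n
    ... | yes h≤f = begin
      2 ^ h * (extensions p + 0)  ≡⟨ cong (2 ^ h *_) (+-identityʳ _) ⟩
      2 ^ h * extensions p        ≤⟨ *-monoˡ-≤ (extensions p) (^-monoʳ-≤ 2 h≤f) ⟩
      2 ^ filled p * extensions p ≡⟨ 2^filled*extensions p ⟩
      2 ^ m                       ∎

open PartialVectors

-- The potential and its growth in one round

module Potential where

  open import Data.Nat using (_+_; _*_; _^_)
  open import Algebra.Properties.CommutativeMonoid.Sum +-0-commutativeMonoid
    using (sum)
  open import Algebra.Properties.Semiring.Sum +-*-semiring using (*-distribˡ-sum)

  -- The cap is what bounds the potential by `C * h` at the end of the game.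
  Φ : ∀ {m} → ℕ → ℕ → (ℕ → Partial m) → ℕ
  Φ h C P = ∑ C (λ b → filled (P b) ⊓ h)

  -- An index already filled is overwritten; in a bin that accepts `x` the old entry has the same
  -- value.
  record-colour : ∀ {m} → List ℕ → Vec Bool m → Fin m → (ℕ → Partial m) → ℕ → Partial m
  record-colour bs x i P b = if does (b ∈? bs) then P b [ i ]≔ just (Vec.lookup x i) else P b

  lookup-record-colour : ∀ {m} bs (x : Vec Bool m) i P b j {v} →
    Vec.lookup (record-colour bs x i P b) j ≡ just v →
    Vec.lookup (P b) j ≡ just v ⊎ (b ∈ bs × j ≡ i × Vec.lookup x i ≡ v)
  lookup-record-colour bs x i P b j eq with b ∈? bs
  ... | no  _    = inj₁ eq
  ... | yes b∈bs with j Fin.≟ i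
  ...   | no j≢i   = inj₁ (trans (sym (Vecₚ.lookup∘update′ j≢i (P b) _)) eq)
  ...   | yes refl =
    inj₂ (b∈bs , refl , just-injective (trans (sym (Vecₚ.lookup∘update i (P b) _)) eq))

  module Step
    (ℓ : ℕ) {C C′ : ℕ} (C≤C′ : C ≤ C′) (P : ℕ → Partial (2 * suc ℓ)) (x : Vec Bool (2 * suc ℓ))
    (P-empty : ∀ b → C ≤ b → filled (P b) ≡ 0)
    (few : 2 ^ suc ℓ * ∑ C (λ b → ⟦ suc ℓ ℕ.≤? filled (P b) ⟧ * agree (P b) x) ≤ C)
    (bs : List ℕ) (bs! : Unique bs) (bs<C′ : All (_< C′) bs)
    (agrees : ∀ {b} → b ∈ bs → ∀ i v → Vec.lookup (P b) i ≡ just v → Vec.lookup x i ≡ v)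
    where

    open ≤-Reasoning

    h = suc ℓ
    m = 2 * h

    light : ℕ → ℕ
    light b = ⟦ b ∈? bs ⟧ * ⟦ filled (P b) ℕ.<? h ⟧

    heavy : ℕ → ℕ
    heavy b = ⟦ h ℕ.≤? filled (P b) ⟧ * agree (P b) x

    gain : Fin m → ℕ
    gain i = ∑ C′ (λ b → light b * vacant (Vec.lookup (P b) i))

    -- A bin that receives a copy accepts `x`, so with at least `h` colours it counts in `heavy`.
    -- Bins from `C` on hold no colours before the round, so the heavy sum may stop at `C`, where
    -- `few` bounds it.
    light+heavy : List.length bs ≤ ∑ C′ light + ∑ C heavy
    light+heavy = begin
      List.length bs                     ≤⟨ length≤∑ bs! bs<C′ ⟩
      ∑ C′ (λ b → ⟦ b ∈? bs ⟧)          ≤⟨ ∑-mono C′ pointwise ⟩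
      ∑ C′ (λ b → light b + heavy b)     ≡⟨ ∑-+ C′ light heavy ⟩
      ∑ C′ light + ∑ C′ heavy            ≤⟨ +-monoʳ-≤ (∑ C′ light) heavy-bins<C ⟩
      ∑ C′ light + ∑ C heavy             ∎
      where
      pointwise : ∀ b → ⟦ b ∈? bs ⟧ ≤ light b + heavy b
      pointwise b with b ∈? bs
      ... | no _ = z≤n
      ... | yes b∈bs with filled (P b) ℕ.<? h
      ...   | yes _ = s≤s z≤n
      ...   | no f≮h = ≤-reflexive (sym (cong₂ _*_ (⟦⟧-yes (h ℕ.≤? filled (P b)) (≮⇒≥ f≮h))
                         (agree-extension (P b) x (agrees b∈bs))))
      no-heavy : ∀ b → C ≤ b → heavy b ≡ 0
      no-heavy b C≤b = cong (_* agree (P b) x) (⟦⟧-no (h ℕ.≤? filled (P b))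
        λ h≤f → contradiction (≤-trans h≤f (≤-reflexive (P-empty b C≤b))) λ ())
      heavy-bins<C : ∑ C′ heavy ≤ ∑ C heavy
      heavy-bins<C = ∑-truncate heavy C≤C′ no-heavy

    -- Double counting: a light bin has fewer than `h` of its `2 * h` indices filled, so at least
    -- `h` choices of the index are new to it.
    gain-total : h * ∑ C′ light ≤ sum gain
    gain-total = begin
      h * ∑ C′ light                                 ≡⟨ ∑-* C′ h light ⟨
      ∑ C′ (λ b → h * light b)                       ≤⟨ ∑-mono C′ pointwise ⟩
      ∑ C′ (λ b → light b * sum (λ i → vacant (Vec.lookup (P b) i)))
        ≡⟨ ∑-cong C′ (λ b → *-distribˡ-sum (light b) (λ i → vacant (Vec.lookup (P b) i))) ⟩
      ∑ C′ (λ b → sum (λ i → light b * vacant (Vec.lookup (P b) i)))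
        ≡⟨ sum-∑ C′ (λ i b → light b * vacant (Vec.lookup (P b) i)) ⟨
      sum gain                                       ∎
      where
      pointwise : ∀ b → h * light b ≤ light b * sum (λ i → vacant (Vec.lookup (P b) i))
      pointwise b with b ∈? bs
      ... | no _ = ≤-reflexive (*-zeroʳ h)
      ... | yes _ with filled (P b) ℕ.<? h
      ...   | no _ = ≤-reflexive (*-zeroʳ h)
      ...   | yes f<h = begin
        h * 1                                    ≡⟨ *-identityʳ h ⟩
        h                                        ≤⟨ +-cancelˡ-≤ (filled (P b)) _ _ half ⟩
        sum (λ i → vacant (Vec.lookup (P b) i))  ≡⟨ +-identityʳ _ ⟨
        1 * sum (λ i → vacant (Vec.lookup (P b) i)) ∎
        where
        half : filled (P b) + h ≤ filled (P b) + sum (λ i → vacant (Vec.lookup (P b) i))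
        half = begin
          filled (P b) + h  ≤⟨ +-mono-≤ (<⇒≤ f<h) (≤-reflexive (sym (+-identityʳ h))) ⟩
          2 * h             ≡⟨ filled+vacant (P b) ⟨
          filled (P b) + sum (λ i → vacant (Vec.lookup (P b) i)) ∎

    -- A light bin is below the cap, so a new colour raises its term by one; no other term
    -- decreases.
    Φ-gain : ∀ i → Φ h C P + gain i ≤ Φ h C′ (record-colour bs x i P)
    Φ-gain i = begin
      Φ h C P + gain i    ≤⟨ +-monoˡ-≤ (gain i) (∑-monoˡ _ C≤C′) ⟩
      Φ h C′ P + gain i   ≡⟨ ∑-+ C′ _ _ ⟨
      ∑ C′ (λ b → filled (P b) ⊓ h + light b * vacant (Vec.lookup (P b) i))
                           ≤⟨ ∑-mono C′ pointwise ⟩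
      Φ h C′ (record-colour bs x i P) ∎
      where
      y = just (Vec.lookup x i)
      vacant≤1 : ∀ u → vacant u ≤ 1
      vacant≤1 nothing  = ≤-refl
      vacant≤1 (just _) = z≤n
      pointwise : ∀ b → filled (P b) ⊓ h + light b * vacant (Vec.lookup (P b) i)
        ≤ filled (record-colour bs x i P b) ⊓ h
      pointwise b with b ∈? bs
      ... | no _ = ≤-reflexive (+-identityʳ _)
      ... | yes _ rewrite filled-update (P b) i (Vec.lookup x i) with filled (P b) ℕ.<? h
      ...   | no _ = ≤-trans (≤-reflexive (+-identityʳ _)) (⊓-monoˡ-≤ h (m≤m+n (filled (P b)) _))
      ...   | yes f<h rewrite m≤n⇒m⊓n≡m (<⇒≤ f<h) | +-identityʳ (vacant (Vec.lookup (P b) i)) =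
        ⊓-glb ≤-refl (≤-trans (+-monoʳ-≤ (filled (P b)) (vacant≤1 (Vec.lookup (P b) i)))
          (≤-trans (≤-reflexive (+-comm (filled (P b)) 1)) f<h))

    -- An index of at least average gain serves half of the light bins, and at most `C` / 2 ^ h
    -- copies lie outside light bins. With denominators cleared, this says that the potential rises
    -- by at least (length bs - C / 2 ^ h) / 2.
    Φ-step : ∃ λ i → 2 ^ h * List.length bs + 2 * 2 ^ h * Φ h C P
      ≤ 2 * 2 ^ h * Φ h C′ (record-colour bs x i P) + C
    Φ-step with some-≥-mean gain
    ... | i , mean = i , (begin
      2 ^ h * List.length bs + 2 * 2 ^ h * Φ h C P
        ≤⟨ +-monoˡ-≤ _ (*-monoʳ-≤ (2 ^ h) light+heavy) ⟩
      2 ^ h * (∑ C′ light + ∑ C heavy) + 2 * 2 ^ h * Φ h C P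
        ≤⟨ +-monoˡ-≤ _ (*-monoʳ-≤ (2 ^ h) (+-monoˡ-≤ (∑ C heavy) light≤gain)) ⟩
      2 ^ h * (2 * gain i + ∑ C heavy) + 2 * 2 ^ h * Φ h C P
        ≡⟨ rearrange (2 ^ h) (gain i) (∑ C heavy) (Φ h C P) ⟩
      2 * 2 ^ h * (Φ h C P + gain i) + 2 ^ h * ∑ C heavy
        ≤⟨ +-mono-≤ (*-monoʳ-≤ (2 * 2 ^ h) (Φ-gain i)) few ⟩
      2 * 2 ^ h * Φ h C′ (record-colour bs x i P) + C ∎)
      where
      rearrange : ∀ D g s f → D * (2 * g + s) + 2 * D * f ≡ 2 * D * (f + g) + D * s
      rearrange = solve-∀
      light≤gain : ∑ C′ light ≤ 2 * gain i
      light≤gain = *-cancelˡ-≤ h (begin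
        h * ∑ C′ light     ≤⟨ gain-total ⟩
        sum gain           ≤⟨ mean ⟩
        2 * h * gain i     ≡⟨ cong (_* gain i) (*-comm 2 h) ⟩
        h * 2 * gain i     ≡⟨ *-assoc h 2 (gain i) ⟩
        h * (2 * gain i)   ∎)

open Potential

-- Naturals as rationals, and rational bounds on cuts

ℕ→ℚᵘ : ℕ → ℚᵘ.ℚᵘ
ℕ→ℚᵘ n = ℚᵘ.mkℚᵘ (ℤ.+ n) 0

toℚᵘ-ℕ→ℚ : ∀ n → ℚ.toℚᵘ (ℕ→ℚ n) ℚᵘ.≃ ℕ→ℚᵘ n
toℚᵘ-ℕ→ℚ n = ℚₚ.toℚᵘ-fromℚᵘ (ℕ→ℚᵘ n)

ℕ→ℚ-+ : ∀ m n → ℕ→ℚ (m ℕ.+ n) ≡ ℕ→ℚ m ℚ.+ ℕ→ℚ n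
ℕ→ℚ-+ m n = ℚₚ.toℚᵘ-injective (begin
  ℚ.toℚᵘ (ℕ→ℚ (m ℕ.+ n))                       ≈⟨ toℚᵘ-ℕ→ℚ (m ℕ.+ n) ⟩
  ℕ→ℚᵘ (m ℕ.+ n)                                ≈⟨ ℚᵘ.*≡* (cong (ℤ._* ℤ.+ 1)
    (cong₂ ℤ._+_ (sym (ℤₚ.*-identityʳ (ℤ.+ m))) (sym (ℤₚ.*-identityʳ (ℤ.+ n))))) ⟩
  ℕ→ℚᵘ m ℚᵘ.+ ℕ→ℚᵘ n                            ≈⟨ ℚᵘₚ.+-cong (toℚᵘ-ℕ→ℚ m) (toℚᵘ-ℕ→ℚ n) ⟨
  ℚ.toℚᵘ (ℕ→ℚ m) ℚᵘ.+ ℚ.toℚᵘ (ℕ→ℚ n)            ≈⟨ ℚₚ.toℚᵘ-homo-+ (ℕ→ℚ m) (ℕ→ℚ n) ⟨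
  ℚ.toℚᵘ (ℕ→ℚ m ℚ.+ ℕ→ℚ n)                     ∎)
  where open ℚᵘₚ.≃-Reasoning

ℕ→ℚ-* : ∀ m n → ℕ→ℚ (m ℕ.* n) ≡ ℕ→ℚ m ℚ.* ℕ→ℚ n
ℕ→ℚ-* m n = ℚₚ.toℚᵘ-injective (begin
  ℚ.toℚᵘ (ℕ→ℚ (m ℕ.* n))                       ≈⟨ toℚᵘ-ℕ→ℚ (m ℕ.* n) ⟩
  ℕ→ℚᵘ (m ℕ.* n)                                ≈⟨ ℚᵘ.*≡* (cong (ℤ._* ℤ.+ 1) (ℤₚ.pos-* m n)) ⟩
  ℕ→ℚᵘ m ℚᵘ.* ℕ→ℚᵘ n                            ≈⟨ ℚᵘₚ.*-cong (toℚᵘ-ℕ→ℚ m) (toℚᵘ-ℕ→ℚ n) ⟨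
  ℚ.toℚᵘ (ℕ→ℚ m) ℚᵘ.* ℚ.toℚᵘ (ℕ→ℚ n)            ≈⟨ ℚₚ.toℚᵘ-homo-* (ℕ→ℚ m) (ℕ→ℚ n) ⟨
  ℚ.toℚᵘ (ℕ→ℚ m ℚ.* ℕ→ℚ n)                     ∎)
  where open ℚᵘₚ.≃-Reasoning

ℕ→ℚ-mono-≤ : ∀ {m n} → m ≤ n → ℕ→ℚ m ℚ.≤ ℕ→ℚ n
ℕ→ℚ-mono-≤ {m} {n} m≤n = ℚₚ.toℚᵘ-cancel-≤ (begin
  ℚ.toℚᵘ (ℕ→ℚ m)  ≃⟨ toℚᵘ-ℕ→ℚ m ⟩
  ℕ→ℚᵘ m          ≤⟨ ℚᵘ.*≤* (ℤₚ.*-monoʳ-≤-nonNeg (ℤ.+ 1) (ℤ.+≤+ m≤n)) ⟩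
  ℕ→ℚᵘ n          ≃⟨ toℚᵘ-ℕ→ℚ n ⟨
  ℚ.toℚᵘ (ℕ→ℚ n)  ∎)
  where open ℚᵘₚ.≤-Reasoning

ℕ→ℚ-nonNeg : ∀ n → ℚ.NonNegative (ℕ→ℚ n)
ℕ→ℚ-nonNeg n = ℚₚ.normalize-nonNeg n 1

ℕ→ℚ-pos : ∀ n .{{_ : ℕ.NonZero n}} → ℚ.Positive (ℕ→ℚ n)
ℕ→ℚ-pos n = ℚₚ.normalize-pos n 1

-- For `v` = a / b the hypotheses give 2 ^ (k b) ≤ d ^ b < 2 ^ a, hence k b ≤ a.
above-log₂ : ∀ {d k v} → 2 ℕ.^ k ≤ d → above (log₂ d) v → ℕ→ℚ k ℚ.≤ v
above-log₂ {d} {k} {v@(ℚ.mkℚ (ℤ.+ a) b-1 _)} 2^k≤d (0<v , d^b<2^a) = ℚₚ.toℚᵘ-cancel-≤ (begin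
  ℚ.toℚᵘ (ℕ→ℚ k)  ≃⟨ toℚᵘ-ℕ→ℚ k ⟩
  ℕ→ℚᵘ k          ≤⟨ ℚᵘ.*≤* (subst₂ ℤ._≤_
    (ℤₚ.pos-* k (suc b-1)) (sym (ℤₚ.*-identityʳ (ℤ.+ a))) (ℤ.+≤+ kb≤a)) ⟩
  ℚ.toℚᵘ v        ∎)
  where
  open ℚᵘₚ.≤-Reasoning
  2^kb<2^a : 2 ℕ.^ (k ℕ.* suc b-1) < 2 ℕ.^ a
  2^kb<2^a = ℕₚ.≤-<-trans (ℕₚ.≤-reflexive (sym (ℕₚ.^-*-assoc 2 k (suc b-1))))
    (ℕₚ.≤-<-trans (ℕₚ.^-monoˡ-≤ (suc b-1) 2^k≤d) d^b<2^a)
  kb≤a : k ℕ.* suc b-1 ≤ a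
  kb≤a = ℕₚ.≮⇒≥ λ a<kb → ℕₚ.<⇒≱ 2^kb<2^a (ℕₚ.^-monoʳ-≤ 2 (ℕₚ.<⇒≤ a<kb))
above-log₂ {v = ℚ.mkℚ ℤ.-[1+ _ ] _ _} _ (ℚ.*<* () , _)

-- Lower bounds on a real are stated for the rationals above it, because `below` of a quotient
-- consults `above` of its denominator.
above-* : ∀ {x y m n} → (∀ {v} → above x v → ℕ→ℚ m ℚ.≤ v) → (∀ {v} → above y v → ℕ→ℚ n ℚ.≤ v) →
  ∀ {v} → above (x Defs.* y) v → ℕ→ℚ (m ℕ.* n) ℚ.≤ v
above-* {m = m} {n} m≤x n≤y {v} (a , b , x<a , y<b , ab≤v) = begin
  ℕ→ℚ (m ℕ.* n)       ≡⟨ ℕ→ℚ-* m n ⟩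
  ℕ→ℚ m ℚ.* ℕ→ℚ n     ≤⟨ ℚₚ.*-monoˡ-≤-nonNeg (ℕ→ℚ m) {{ℕ→ℚ-nonNeg m}} (n≤y y<b) ⟩
  ℕ→ℚ m ℚ.* b         ≤⟨ ℚₚ.*-monoʳ-≤-nonNeg b {{b≥0}} (m≤x x<a) ⟩
  a ℚ.* b              ≤⟨ ab≤v ⟩
  v                     ∎
  where
  open ℚₚ.≤-Reasoning
  b≥0 : ℚ.NonNegative b
  b≥0 = ℚ.nonNegative (ℚₚ.≤-trans (ℚₚ.nonNegative⁻¹ (ℕ→ℚ n) {{ℕ→ℚ-nonNeg n}}) (n≤y y<b))

above-^ : ∀ {x m} → (∀ {v} → above x v → ℕ→ℚ m ℚ.≤ v) →
  ∀ k {v} → above (x Defs.^ k) v → ℕ→ℚ (m ℕ.^ k) ℚ.≤ v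
above-^ m≤x zero    = ℚₚ.<⇒≤
above-^ {x} {m} m≤x (suc k) = above-* {x} {x Defs.^ k} {m} {m ℕ.^ k} m≤x (above-^ m≤x k)

-- For `q` ≥ 0 the approximation `b` of the denominator can be lowered to `E`; for `q` ≤ 0 the
-- product is at most 0, hence below `n`.
below-/ : ∀ {x n E} → 0 < n → (∀ {v} → above x v → ℕ→ℚ E ℚ.≤ v) →
  ∀ {q} → below (fromℕ n Defs./ x) q → q ℚ.* ℕ→ℚ E ℚ.< ℕ→ℚ n
below-/ {n = n@(suc _)} {E} _ E≤x {q} (a , b , a<n , x<b , qb≤a) with ℚₚ.≤-total 0ℚ q
... | inj₁ 0≤q = begin-strict
  q ℚ.* ℕ→ℚ E  ≤⟨ ℚₚ.*-monoˡ-≤-nonNeg q {{ℚ.nonNegative 0≤q}} (E≤x x<b) ⟩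
  q ℚ.* b      ≤⟨ qb≤a ⟩
  a            <⟨ a<n ⟩
  ℕ→ℚ n        ∎
  where open ℚₚ.≤-Reasoning
... | inj₂ q≤0 = begin-strict
  q ℚ.* ℕ→ℚ E   ≤⟨ ℚₚ.*-monoʳ-≤-nonNeg (ℕ→ℚ E) {{ℕ→ℚ-nonNeg E}} q≤0 ⟩
  0ℚ ℚ.* ℕ→ℚ E  ≡⟨ ℚₚ.*-zeroˡ (ℕ→ℚ E) ⟩
  0ℚ            <⟨ ℚₚ.positive⁻¹ (ℕ→ℚ n) {{ℕ→ℚ-pos n}} ⟩
  ℕ→ℚ n         ∎
  where open ℚₚ.≤-Reasoning

-- `lim` asks for one rational above `q` that serves all large `K`. Density supplies `r` strictly
-- between `q` and `n / E`, and its distance from `n / E` turns the weak bound on the cost into the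
-- strict one in `ratio`.
asymptoticRatio-≥ : ∀ {d} (A : OnlineAlgorithm d) n E .{{_ : ℕ.NonZero E}} →
  (∀ K → ∃₂ λ L opt → IsOPT L opt × K ≤ opt × n ℕ.* opt ≤ E ℕ.* cost A L) →
  ∀ {q} → q ℚ.* ℕ→ℚ E ℚ.< ℕ→ℚ n → asymptoticRatio A q
-- Starting at `K` = 1 makes `opt` positive, so multiplying by it preserves strict inequalities.
asymptoticRatio-≥ A n E hard {q} qE<n = r , q<r , 1 , λ K 1≤K →
  let L , opt , isOPT , K≤opt , bound = hard K in
  (L , opt , isOPT , K≤opt) , r*opt<cost L opt (ℕₚ.≤-trans 1≤K K≤opt) bound
  where
  open ℚₚ.≤-Reasoning
  E⁻¹ : ℚ
  E⁻¹ = (ℚ.1/ ℕ→ℚ E) {{ℚₚ.pos⇒nonZero (ℕ→ℚ E) {{ℕ→ℚ-pos E}}}}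
  R : ℚ
  R = ℕ→ℚ n ℚ.* E⁻¹
  RE≡n : R ℚ.* ℕ→ℚ E ≡ ℕ→ℚ n
  RE≡n = trans (ℚₚ.*-assoc (ℕ→ℚ n) E⁻¹ (ℕ→ℚ E))
    (trans (cong (ℕ→ℚ n ℚ.*_) (ℚₚ.*-inverseˡ (ℕ→ℚ E) {{ℚₚ.pos⇒nonZero (ℕ→ℚ E) {{ℕ→ℚ-pos E}}}}))
      (ℚₚ.*-identityʳ (ℕ→ℚ n)))
  q<R : q ℚ.< R
  q<R = ℚₚ.*-cancelʳ-<-nonNeg (ℕ→ℚ E) {{ℕ→ℚ-nonNeg E}} (subst (q ℚ.* ℕ→ℚ E ℚ.<_) (sym RE≡n) qE<n)
  between = ℚₚ.<-dense q<R
  r = proj₁ between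
  q<r = proj₁ (proj₂ between)
  rE<n : r ℚ.* ℕ→ℚ E ℚ.< ℕ→ℚ n
  rE<n = subst (r ℚ.* ℕ→ℚ E ℚ.<_) RE≡n
    (ℚₚ.*-monoˡ-<-pos (ℕ→ℚ E) {{ℕ→ℚ-pos E}} (proj₂ (proj₂ between)))
  r*opt<cost : ∀ L opt → 0 < opt → n ℕ.* opt ≤ E ℕ.* cost A L → r ℚ.* ℕ→ℚ opt ℚ.< ℕ→ℚ (cost A L)
  r*opt<cost L opt@(suc _) _ bound = ℚₚ.*-cancelˡ-<-nonNeg (ℕ→ℚ E) {{ℕ→ℚ-nonNeg E}} (begin-strict
    ℕ→ℚ E ℚ.* (r ℚ.* ℕ→ℚ opt)   ≡⟨ ℚₚ.*-assoc (ℕ→ℚ E) r (ℕ→ℚ opt) ⟨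
    ℕ→ℚ E ℚ.* r ℚ.* ℕ→ℚ opt     ≡⟨ cong (ℚ._* ℕ→ℚ opt) (ℚₚ.*-comm (ℕ→ℚ E) r) ⟩
    r ℚ.* ℕ→ℚ E ℚ.* ℕ→ℚ opt     <⟨ ℚₚ.*-monoˡ-<-pos (ℕ→ℚ opt) {{ℕ→ℚ-pos opt}} rE<n ⟩
    ℕ→ℚ n ℚ.* ℕ→ℚ opt            ≡⟨ ℕ→ℚ-* n opt ⟨
    ℕ→ℚ (n ℕ.* opt)               ≤⟨ ℕ→ℚ-mono-≤ bound ⟩
    ℕ→ℚ (E ℕ.* cost A L)          ≡⟨ ℕ→ℚ-* E (cost A L) ⟩
    ℕ→ℚ E ℚ.* ℕ→ℚ (cost A L)      ∎)

-- Packings, relabelling of bins, and the existence of OPT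

module Packings where

  open import Algebra.Properties.CommutativeMonoid.Sum ℚₚ.+-0-commutativeMonoid
    using (sum; sum-cong-≗)

  private variable
    d n : ℕ
    B B′ : Set

  weight : Item d → Fin d → ℚ
  weight x = Vec.lookup (vec x)

  sum-nonneg : (f : Fin n → ℚ) → (∀ i → 0ℚ ℚ.≤ f i) → 0ℚ ℚ.≤ sum f
  sum-nonneg {zero}  f 0≤f = ℚₚ.≤-refl
  sum-nonneg {suc n} f 0≤f = ℚₚ.+-mono-≤ (0≤f zero) (sum-nonneg (f ∘ suc) (0≤f ∘ suc))

  term≤sum : (f : Fin n → ℚ) → (∀ i → 0ℚ ℚ.≤ f i) → ∀ i → f i ℚ.≤ sum f
  term≤sum {suc n} f 0≤f zero    = subst (ℚ._≤ sum f) (ℚₚ.+-identityʳ (f zero))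
    (ℚₚ.+-monoʳ-≤ (f zero) (sum-nonneg (f ∘ suc) (0≤f ∘ suc)))
  term≤sum {suc n} f 0≤f (suc i) = subst (ℚ._≤ sum f) (ℚₚ.+-identityˡ (f (suc i)))
    (ℚₚ.+-mono-≤ (0≤f zero) (term≤sum (f ∘ suc) (0≤f ∘ suc) i))

  two-terms≤sum : (f : Fin n → ℚ) → (∀ i → 0ℚ ℚ.≤ f i) →
    ∀ i j → i ≢ j → f i ℚ.+ f j ℚ.≤ sum f
  two-terms≤sum f 0≤f zero    zero    i≢j = contradiction refl i≢j
  two-terms≤sum f 0≤f zero    (suc j) i≢j =
    ℚₚ.+-monoʳ-≤ (f zero) (term≤sum (f ∘ suc) (0≤f ∘ suc) j)
  two-terms≤sum f 0≤f (suc i) zero    i≢j = subst (ℚ._≤ sum f) (ℚₚ.+-comm (f zero) (f (suc i)))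
    (ℚₚ.+-monoʳ-≤ (f zero) (term≤sum (f ∘ suc) (0≤f ∘ suc) i))
  two-terms≤sum f 0≤f (suc i) (suc j) i≢j = ℚₚ.≤-trans
    (two-terms≤sum (f ∘ suc) (0≤f ∘ suc) i j (i≢j ∘ cong suc))
    (subst (ℚ._≤ sum f) (ℚₚ.+-identityˡ _) (ℚₚ.+-monoˡ-≤ (sum (f ∘ suc)) (0≤f zero)))

  -- As weights are nonnegative, the load of the shared bin is at least the sum of these two terms.
  packed-together : {L : Input d} (P : Packing L) → ∀ {i j} → i ≢ j → bin P i ≡ bin P j →
    ∀ s → weight (lookup L i) s ℚ.+ weight (lookup L j) s ℚ.≤ 1ℚ
  packed-together {L = L} P {i} {j} i≢j bᵢ≡bⱼ s = ℚₚ.≤-trans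
    (subst₂ (λ u v → u ℚ.+ v ℚ.≤ load P (bin P i) s) (same-bin refl) (same-bin (sym bᵢ≡bⱼ))
      (two-terms≤sum term nonneg i j i≢j))
    (feasible P (bin P i) s)
    where
    term : Fin (length L) → ℚ
    term k = if does (bin P k Fin.≟ bin P i) then weight (lookup L k) s else 0ℚ
    same-bin : ∀ {k} → bin P k ≡ bin P i → term k ≡ weight (lookup L k) s
    same-bin {k} eq rewrite dec-true (bin P k Fin.≟ bin P i) eq = refl
    nonneg : ∀ k → 0ℚ ℚ.≤ term k
    nonneg k with does (bin P k Fin.≟ bin P i)
    ... | true  = 0≤vec (lookup L k) s
    ... | false = ℚₚ.≤-refl

  loadOf : DecidableEquality B → (L : Input d) → (Fin (length L) → B) → B → Fin d → ℚ
  loadOf _≟_ L f b s = sum λ i → if does (f i ≟ b) then weight (lookup L i) s else 0ℚ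

  -- Only labels in the image of `f` are constrained, so the label type may be infinite.
  Feasible : DecidableEquality B → (L : Input d) → (Fin (length L) → B) → Set
  Feasible _≟_ L f = ∀ i s → loadOf _≟_ L f (f i) s ℚ.≤ 1ℚ

  -- Feasibility depends only on which items share a bin.
  feasible-transfer : (_≟_ : DecidableEquality B) (_≟′_ : DecidableEquality B′) (L : Input d)
    (f : Fin (length L) → B) (f′ : Fin (length L) → B′) →
    (∀ i j → f i ≡ f j → f′ i ≡ f′ j) → (∀ i j → f′ i ≡ f′ j → f i ≡ f j) →
    Feasible _≟_ L f → Feasible _≟′_ L f′
  feasible-transfer _≟_ _≟′_ L f f′ to from feas i s = subst (ℚ._≤ 1ℚ)
    (sum-cong-≗ λ j → cong (if_then weight (lookup L j) s else 0ℚ)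
      (does-⇔ (mk⇔ (to j i) (from j i)) (f j ≟ f i) (f′ j ≟′ f′ i)))
    (feas i s)

  -- Bins may stay empty here, unlike in `Packing`, which makes the notion monotone in `c`.
  Packable : Input d → ℕ → Set
  Packable L c = ∃ λ (f : Fin (length L) → Fin c) → Feasible Fin._≟_ L f

  packable-mono : ∀ {L : Input d} {c c′} → c ≤ c′ → Packable L c → Packable L c′
  packable-mono {L = L} c≤c′ (f , feas) = (λ i → inject≤ (f i) c≤c′) ,
    feasible-transfer Fin._≟_ Fin._≟_ L f _ (λ i j → cong (λ b → inject≤ b c≤c′))
      (λ i j → Finₚ.inject≤-injective c≤c′ c≤c′ _ _) feas

  packing-packable : ∀ {L : Input d} (P : Packing L) → Packable L (#bins P)
  packing-packable P = bin P , feasible P ∘ bin P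

  anyVec? : ∀ {c n} {Q : Vec (Fin c) n → Set} → (∀ v → Dec (Q v)) → Dec (∃ Q)
  anyVec? {n = zero}  Q? = map′ (λ q → [] , q) (λ { ([] , q) → q }) (Q? [])
  anyVec? {n = suc n} Q? = map′ (λ (b , v , q) → b ∷ v , q) (λ { (b ∷ v , q) → b , v , q })
    (Finₚ.any? λ b → anyVec? λ v → Q? (b ∷ v))

  packable? : ∀ (L : Input d) c → Dec (Packable L c)
  packable? L c = map′
    (λ (v , feas) → Vec.lookup v , feas)
    (λ (f , feas) → Vec.tabulate f ,
      feasible-transfer Fin._≟_ Fin._≟_ L f (Vec.lookup (Vec.tabulate f))
      (λ i j eq → trans (lookup-tab f i) (trans eq (sym (lookup-tab f j))))
      (λ i j eq → trans (sym (lookup-tab f i)) (trans eq (lookup-tab f j))) feas)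
    (anyVec? λ v → Finₚ.all? λ i → Finₚ.all? λ s →
      loadOf Fin._≟_ L (Vec.lookup v) (Vec.lookup v i) s ℚₚ.≤? 1ℚ)
    where
    lookup-tab = Vecₚ.lookup∘tabulate

  minimal⇒isOPT : ∀ {L : Input d} {c} → Packable L c →
    (∀ {c′} → c′ < c → ¬ Packable L c′) → IsOPT L c
  minimal⇒isOPT {L = L} {c} (f , feas) minimal =
    (record { #bins = c ; bin = f ; nonEmpty = used ; feasible = λ b → feas′ b (used b) } , refl) ,
    λ P → ≮⇒≥ λ P<c → minimal P<c (packing-packable P)
    where
    feas′ : ∀ b → (∃ λ i → f i ≡ b) → ∀ s → loadOf Fin._≟_ L f b s ℚ.≤ 1ℚ
    feas′ b (i , refl) = feas i
    drop-bin : ∀ {c} (f : Fin (length L) → Fin c) → Feasible Fin._≟_ L f → ∀ b →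
      (∀ i → b ≢ f i) → ∃ λ c′ → c′ < c × Packable L c′
    drop-bin {suc c} f feas b b≢f = c , ≤-refl , (λ i → punchOut (b≢f i)) ,
      feasible-transfer Fin._≟_ Fin._≟_ L f _ (λ i j → Finₚ.punchOut-cong b)
        (λ i j → Finₚ.punchOut-injective (b≢f i) (b≢f j)) feas
    used : ∀ b → ∃ λ i → f i ≡ b
    used b = decidable-stable (Finₚ.any? λ i → f i Fin.≟ b) λ unused →
      let _ , c′<c , packable = drop-bin f feas b (λ i b≡fi → unused (i , sym b≡fi))
      in minimal c′<c packable

  -- Search downwards from `c` to the first count whose predecessor fails; by monotonicity all
  -- smaller counts then fail too.
  OPT-exists : ∀ {L : Input d} {c} → Packable L c → ∃ λ opt → IsOPT L opt × opt ≤ c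
  OPT-exists {c = zero}  packable = 0 , minimal⇒isOPT packable (λ ()) , z≤n
  OPT-exists {L = L} {suc c} packable with packable? L c
  ... | yes packable′ =
    let opt , isOPT , opt≤c = OPT-exists packable′ in opt , isOPT , m≤n⇒m≤1+n opt≤c
  ... | no  ¬packable = suc c ,
    minimal⇒isOPT packable (λ { (s≤s c′≤c) → ¬packable ∘ packable-mono {L = L} c′≤c }) , ≤-refl

  copies : ℕ → Item d → Input d → Input d
  copies n x L = List.replicate n x List.++ L

  2≰1 : ¬ (1ℚ ℚ.+ 1ℚ ℚ.≤ 1ℚ)
  2≰1 2≤1 with () ← ℚₚ.≤⇒≤ᵇ 2≤1

  -- Bins used by an online algorithm

  module _ (A : OnlineAlgorithm d) where

    -- Items are named by value and bins by number, so that the statement persists when the input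
    -- grows and positions shift.
    Placed : Input d → Item d → ℕ → Set
    Placed L y b = ∃ λ j → lookup L j ≡ y × toℕ (bin (pack A L) j) ≡ b

    placed-∷ : ∀ {L x y b} → Placed L y b → Placed (x ∷ L) y b
    placed-∷ {L} {x} (j , Lj≡y , binj≡b) = suc j , Lj≡y , trans (irrevocable A x L j) binj≡b

    placed<cost : ∀ {L y b} → Placed L y b → b < cost A L
    placed<cost {L} (j , _ , refl) = toℕ<n (bin (pack A L) j)

    -- Otherwise an item in the bin of `L` numbered `cost A (x ∷ L)` would keep that number, which
    -- is out of range.
    cost-∷ : ∀ x L → cost A L ≤ cost A (x ∷ L)
    cost-∷ x L = ≮⇒≥ λ c<cost →
      let i , bᵢ≡b = nonEmpty (pack A L) (Fin.fromℕ< c<cost)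
          b≡ = trans (irrevocable A x L i) (trans (cong toℕ bᵢ≡b) (Finₚ.toℕ-fromℕ< c<cost))
      in <-irrefl b≡ (toℕ<n (bin (pack A (x ∷ L)) (suc i)))

    cost-copies : ∀ n x L → cost A L ≤ cost A (copies n x L)
    cost-copies zero    x L = ≤-refl
    cost-copies (suc n) x L = ≤-trans (cost-copies n x L) (cost-∷ x (copies n x L))

    placed-copies : ∀ n {L x y b} → Placed L y b → Placed (copies n x L) y b
    placed-copies zero    p = p
    placed-copies (suc n) p = placed-∷ (placed-copies n p)

    new-bin-compatible : ∀ {x L y} → Placed L y (toℕ (bin (pack A (x ∷ L)) zero)) →
      ∀ s → weight y s ℚ.+ weight x s ℚ.≤ 1ℚ
    new-bin-compatible {x} {L} (j , refl , eq) = packed-together (pack A (x ∷ L)) {suc j}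
      (λ ()) (toℕ-injective (trans (irrevocable A x L j) eq))

    -- Two copies in one bin would load coordinate `s` with 2, so the bins are distinct.
    -- Compatibility is recorded with respect to the items that preceded all copies.
    copies-bins : ∀ n x L s → weight x s ≡ 1ℚ → ∃ λ bs →
      length bs ≡ n × Unique bs × All (Placed (copies n x L) x) bs ×
      (∀ {b y} → b ∈ bs → Placed L y b → ∀ s → weight y s ℚ.+ weight x s ℚ.≤ 1ℚ)
    copies-bins zero    x L s xₛ≡1 = [] , refl , [] , [] , λ ()
    copies-bins (suc n) x L s xₛ≡1 with copies-bins n x L s xₛ≡1
    ... | bs , len , bs! , placed , compatible =
      b₀ ∷ bs , cong suc len , All.map fresh placed ∷ bs! ,
      (zero , refl , refl) ∷ All.map placed-∷ placed ,
      λ where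
        (here refl)  y-placed → new-bin-compatible (placed-copies n y-placed)
        (there b∈bs) y-placed → compatible b∈bs y-placed
      where
      b₀ = toℕ (bin (pack A (x ∷ copies n x L)) zero)
      fresh : ∀ {b} → Placed (copies n x L) x b → b₀ ≢ b
      fresh x-placed refl = 2≰1
        (subst (λ u → u ℚ.+ u ℚ.≤ 1ℚ) xₛ≡1 (new-bin-compatible x-placed s))

  -- Applied to an optimal packing, this makes OPT as large as desired.
  copies-need-bins : ∀ n (x : Item d) L s → weight x s ≡ 1ℚ →
    (P : Packing (copies n x L)) → n ≤ #bins P
  copies-need-bins n x L s xₛ≡1 P = Finₚ.injective⇒≤ {f = bin P ∘ position n} injective
    where
    position : ∀ n → Fin n → Fin (length (copies n x L))
    position (suc n) zero    = zero
    position (suc n) (suc i) = suc (position n i)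
    position-injective : ∀ n {i j} → position n i ≡ position n j → i ≡ j
    position-injective (suc n) {zero}  {zero}  _  = refl
    position-injective (suc n) {suc i} {suc j} eq =
      cong suc (position-injective n (Finₚ.suc-injective eq))
    lookup-position : ∀ n i → lookup (copies n x L) (position n i) ≡ x
    lookup-position (suc n) zero    = refl
    lookup-position (suc n) (suc i) = lookup-position n i
    injective : ∀ {i j} → bin P (position n i) ≡ bin P (position n j) → i ≡ j
    injective {i} {j} eq with i Fin.≟ j
    ... | yes i≡j = i≡j
    ... | no  i≢j = contradiction
      (subst₂ (λ u v → u ℚ.+ v ℚ.≤ 1ℚ)
        (trans (cong (λ y → weight y s) (lookup-position n i)) xₛ≡1)
        (trans (cong (λ y → weight y s) (lookup-position n j)) xₛ≡1)
        (packed-together P (i≢j ∘ position-injective n) eq s)) 2≰1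

open Packings

-- Copies of colour classes as offline bins

module Adversary where

  open import Data.Nat using (_+_; _*_; _^_)
  open import Algebra.Properties.CommutativeSemigroup *-commutativeSemigroup using (x∙yz≈y∙xz)

  private variable
    d : ℕ

  module _ {K : Set} (_≟K_ : DecidableEquality K) where

    infix 4 _≟S_
    _≟S_ : DecidableEquality (K × ℕ)
    _≟S_ = ≡-dec _≟K_ ℕ._≟_

    assign-copies : ∀ (n : ℕ) {x : Item d} {L} → K → (Fin (length L) → K × ℕ) →
      Fin (length (copies n x L)) → K × ℕ
    assign-copies zero    c f         = f
    assign-copies (suc n) c f zero    = c , n
    assign-copies (suc n) c f (suc j) = assign-copies n c f j

    module _ {x : Item d} {L : Input d} (c : K) (f : Fin (length L) → K × ℕ) (s : Fin d) where

      load′ : ℕ → K × ℕ → ℚ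
      load′ n b = loadOf _≟S_ (copies n x L) (assign-copies n c f) b s

      load-copies-unchanged : ∀ n {b} → (∀ {k} → k < n → (c , k) ≢ b) →
        load′ n b ≡ loadOf _≟S_ L f b s
      load-copies-unchanged zero    ≢b = refl
      load-copies-unchanged (suc n) {b} ≢b rewrite dec-false ((c , n) ≟S b) (≢b ≤-refl) =
        trans (ℚₚ.+-identityˡ _) (load-copies-unchanged n λ k<n → ≢b (m≤n⇒m≤1+n k<n))

      -- Copies of one vertex carry different numbers, so a bin receives at most one of them.
      load-copies : ∀ n b → load′ n b ℚ.≤ loadOf _≟S_ L f b s ℚ.+ weight x s
      load-copies zero    b = subst (ℚ._≤ loadOf _≟S_ L f b s ℚ.+ weight x s) (ℚₚ.+-identityʳ _)
        (ℚₚ.+-monoʳ-≤ (loadOf _≟S_ L f b s) (0≤vec x s))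
      load-copies (suc n) b with (c , n) ≟S b
      ... | yes refl = ℚₚ.≤-reflexive (trans
        (cong (weight x s ℚ.+_) (load-copies-unchanged n λ k<n → λ { refl → <-irrefl refl k<n }))
        (ℚₚ.+-comm (weight x s) _))
      ... | no _ = subst (ℚ._≤ loadOf _≟S_ L f b s ℚ.+ weight x s)
        (sym (ℚₚ.+-identityˡ (load′ n b))) (load-copies n b)

    assign-copies-< : ∀ {N} n {x : Item d} {L} (c : K) (f : Fin (length L) → K × ℕ) → n ≤ N →
      (∀ j → proj₂ (f j) < N) → ∀ j → proj₂ (assign-copies n {x} {L} c f j) < N
    assign-copies-< zero    c f n≤N f<N j       = f<N j
    assign-copies-< (suc n) c f n≤N f<N zero    = n≤N
    assign-copies-< (suc n) c f n≤N f<N (suc j) = assign-copies-< n c f (<⇒≤ n≤N) f<N j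

  -- The game against the algorithm

  module Game {d : ℕ} .{{_ : NonZero d}} (A : OnlineAlgorithm d) (N ℓ : ℕ) where

    h m D : ℕ
    h = suc ℓ
    m = 2 * h
    D = 2 ^ h

    Colour : Set
    Colour = Fin m × Bool

    _≟C_ : DecidableEquality Colour
    _≟C_ = ≡-dec Finₚ._≟_ Bool._≟_

    -- Small enough that `d` conflicts fit into one coordinate, yet any single conflict overfills a
    -- coordinate of load 1.
    ε : ℚ
    ε = (ℚ.1/ ℕ→ℚ d) {{ℚₚ.pos⇒nonZero (ℕ→ℚ d) {{ℕ→ℚ-pos d}}}}

    d*ε≡1 : ℕ→ℚ d ℚ.* ε ≡ 1ℚ
    d*ε≡1 = ℚₚ.*-inverseʳ (ℕ→ℚ d) {{ℚₚ.pos⇒nonZero (ℕ→ℚ d) {{ℕ→ℚ-pos d}}}}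

    0<ε : 0ℚ ℚ.< ε
    0<ε = ℚₚ.positive⁻¹ ε {{ℚₚ.1/pos⇒pos (ℕ→ℚ d) {{ℕ→ℚ-pos d}}}}

    *ε-mono : ∀ {t u} → t ≤ u → ℕ→ℚ t ℚ.* ε ℚ.≤ ℕ→ℚ u ℚ.* ε
    *ε-mono t≤u = ℚₚ.*-monoʳ-≤-nonNeg ε {{ℚ.nonNegative (ℚₚ.<⇒≤ 0<ε)}} (ℕ→ℚ-mono-≤ t≤u)

    *ε-≤1 : ∀ {t} → t ≤ d → ℕ→ℚ t ℚ.* ε ℚ.≤ 1ℚ
    *ε-≤1 t≤d = ℚₚ.≤-trans (*ε-mono t≤d) (ℚₚ.≤-reflexive d*ε≡1)

    *ε-suc : ∀ t → ℕ→ℚ t ℚ.* ε ℚ.+ ε ≡ ℕ→ℚ (suc t) ℚ.* ε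
    *ε-suc t = trans (ℚₚ.+-comm _ ε) (trans
      (cong (ℚ._+ ℕ→ℚ t ℚ.* ε) (sym (ℚₚ.*-identityˡ ε)))
      (trans (sym (ℚₚ.*-distribʳ-+ ε 1ℚ (ℕ→ℚ t))) (cong (ℚ._* ε) (sym (ℕ→ℚ-+ 1 t)))))

    ε≤1 : ε ℚ.≤ 1ℚ
    ε≤1 = ℚₚ.≤-trans (ℚₚ.≤-reflexive (sym (ℚₚ.*-identityˡ ε))) (*ε-≤1 {1} (ℕ.>-nonZero⁻¹ d))

    -- The current vertex is adjacent to an earlier one exactly when its label contradicts that
    -- colour; vertices still to come are uncoloured.
    conflict : Vec Bool m → Maybe Colour → ℚ
    conflict x nothing        = 0ℚ
    conflict x (just (i , v)) = if does (Vec.lookup x i Bool.≟ v) then 0ℚ else ε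

    conflict-nonneg : ∀ x u → 0ℚ ℚ.≤ conflict x u
    conflict-nonneg x nothing = ℚₚ.≤-refl
    conflict-nonneg x (just (i , v)) with does (Vec.lookup x i Bool.≟ v)
    ... | true  = ℚₚ.≤-refl
    ... | false = ℚₚ.<⇒≤ 0<ε

    conflict≤ε : ∀ x u → conflict x u ℚ.≤ ε
    conflict≤ε x nothing = ℚₚ.<⇒≤ 0<ε
    conflict≤ε x (just (i , v)) with does (Vec.lookup x i Bool.≟ v)
    ... | true  = ℚₚ.<⇒≤ 0<ε
    ... | false = ℚₚ.≤-refl

    conflict-self : ∀ x i → conflict x (just (i , Vec.lookup x i)) ≡ 0ℚ
    conflict-self x i rewrite dec-true (Vec.lookup x i Bool.≟ Vec.lookup x i) refl = refl

    module Vertex (colour : Fin d → Maybe Colour) (τ : Fin d) (x : Vec Bool m) where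

      entry : Fin d → ℚ
      entry s = if does (s Fin.≟ τ) then 1ℚ else conflict x (colour s)

      entry-τ : entry τ ≡ 1ℚ
      entry-τ rewrite dec-true (τ Fin.≟ τ) refl = refl

      entry-≢ : ∀ {s} → s ≢ τ → entry s ≡ conflict x (colour s)
      entry-≢ {s} s≢τ rewrite dec-false (s Fin.≟ τ) s≢τ = refl

      0≤entry : ∀ s → 0ℚ ℚ.≤ entry s
      0≤entry s with does (s Fin.≟ τ)
      ... | true  = ℚₚ.nonNegative⁻¹ 1ℚ
      ... | false = conflict-nonneg x (colour s)

      entry≤1 : ∀ s → entry s ℚ.≤ 1ℚ
      entry≤1 s with does (s Fin.≟ τ)
      ... | true  = ℚₚ.≤-refl
      ... | false = ℚₚ.≤-trans (conflict≤ε x (colour s)) ε≤1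

      vertex : Item d
      vertex = record
        { vec     = Vec.tabulate entry
        ; 0≤vec   = λ s → subst (0ℚ ℚ.≤_) (sym (Vecₚ.lookup∘tabulate entry s)) (0≤entry s)
        ; vec≤1   = λ s → subst (ℚ._≤ 1ℚ) (sym (Vecₚ.lookup∘tabulate entry s)) (entry≤1 s)
        ; nonZero = λ eq → ℚₚ.1≢0 (trans (sym (trans (Vecₚ.lookup∘tabulate entry τ) entry-τ))
            (trans (cong (λ v → Vec.lookup v τ) eq) (Vecₚ.lookup-replicate τ 0ℚ)))
        }

      weight-vertex : ∀ s → weight vertex s ≡ entry s
      weight-vertex = Vecₚ.lookup∘tabulate entry

      paint : Fin m → Fin d → Maybe Colour
      paint i s = if does (s Fin.≟ τ) then just (i , Vec.lookup x i) else colour s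

      paint-τ : ∀ i → paint i τ ≡ just (i , Vec.lookup x i)
      paint-τ i rewrite dec-true (τ Fin.≟ τ) refl = refl

      paint-≢ : ∀ i {s} → s ≢ τ → paint i s ≡ colour s
      paint-≢ i {s} s≢τ rewrite dec-false (s Fin.≟ τ) s≢τ = refl

    -- After t vertices: P b records the colours in bin b of the algorithm, and
    -- slot is an offline packing into bins (colour , copy).
    record State (t : ℕ) : Set where
      field
        L          : Input d
        colour     : Fin d → Maybe Colour
        uncoloured : ∀ s → t ≤ toℕ s → colour s ≡ nothing
        P          : ℕ → Partial m
        -- A recorded colour is backed by an item filling a coordinate of that colour, where any
        -- contradicting label has weight `ε`.
        witness    : ∀ b i v → Vec.lookup (P b) i ≡ just v → ∃₂ λ y s →
          Placed A L y b × weight y s ≡ 1ℚ × colour s ≡ just (i , v)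
        -- The sum of `Φ-step` over the rounds, with every earlier cost raised to the present one.
        potential  : t * (D * N) ≤ 2 * D * Φ h (cost A L) P + t * cost A L
        slot       : Fin (length L) → Colour × ℕ
        slot<N     : ∀ j → proj₂ (slot j) < N
        load-uncoloured : ∀ b s → colour s ≡ nothing → loadOf (_≟S_ _≟C_) L slot b s ℚ.≤ 0ℚ
        -- In a bin of the class of `s`, coordinate `s` carries at most one copy of the vertex
        -- itself and no conflicts; in other bins it carries only conflicts, at most `ε` per round.
        load-coloured   : ∀ b s c → colour s ≡ just c →
          (c ≡ proj₁ b × loadOf (_≟S_ _≟C_) L slot b s ℚ.≤ 1ℚ)
          ⊎ loadOf (_≟S_ _≟C_) L slot b s ℚ.≤ ℕ→ℚ t ℚ.* ε
        crowded    : 0 < t → (Q : Packing L) → N ≤ #bins Q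

    open State

    start : State 0
    start = record
      { L = [] ; colour = λ _ → nothing ; uncoloured = λ _ _ → refl
      ; P = λ _ → Vec.replicate m nothing
      ; witness = λ b i v eq → contradiction (trans (sym (Vecₚ.lookup-replicate i nothing)) eq) λ ()
      ; potential = z≤n
      ; slot = λ () ; slot<N = λ ()
      ; load-uncoloured = λ _ _ _ → ℚₚ.≤-refl
      ; load-coloured = λ _ _ _ ()
      ; crowded = λ ()
      }

    step : ∀ {t} → t < d → State t → State (suc t)
    step {t} t<d S = record
      { L = L′ ; colour = paint i ; uncoloured = uncoloured′
      ; P = P′ ; witness = witness′ ; potential = potential′
      ; slot = slot′ ; slot<N = assign-copies-< _≟C_ N c (slot S) ≤-refl (slot<N S)
      ; load-uncoloured = load-uncoloured′ ; load-coloured = load-coloured′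
      ; crowded = λ _ → copies-need-bins N vertex (L S) τ weight-τ
      }
      where
      τ : Fin d
      τ = fromℕ< t<d
      toℕ-τ : toℕ τ ≡ t
      toℕ-τ = Finₚ.toℕ-fromℕ< t<d
      C : ℕ
      C = cost A (L S)
      -- The label depends only on the bins before the round; the index `i` is chosen below, after
      -- the copies have been packed into `bs`.
      chosen = few-full-agree h C (P S)
      x : Vec Bool m
      x = proj₁ chosen
      open Vertex (colour S) τ x
      colour-τ : colour S τ ≡ nothing
      colour-τ = uncoloured S τ (≤-reflexive (sym toℕ-τ))
      coloured≢τ : ∀ {s c} → colour S s ≡ just c → s ≢ τ
      coloured≢τ eq refl = contradiction (trans (sym eq) colour-τ) λ ()
      weight-τ : weight vertex τ ≡ 1ℚ
      weight-τ = trans (weight-vertex τ) entry-τ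
      weight-≢ : ∀ {s} → s ≢ τ → weight vertex s ≡ conflict x (colour S s)
      weight-≢ {s} s≢τ = trans (weight-vertex s) (entry-≢ s≢τ)
      L′ : Input d
      L′ = copies N vertex (L S)
      binned = copies-bins A N vertex (L S) τ weight-τ
      bs : List ℕ
      bs = proj₁ binned
      bs-length = proj₁ (proj₂ binned)
      bs! = proj₁ (proj₂ (proj₂ binned))
      bs-placed : All (Placed A L′ vertex) bs
      bs-placed = proj₁ (proj₂ (proj₂ (proj₂ binned)))
      compatible : ∀ {b y} → b ∈ bs → Placed A (L S) y b →
        ∀ s → weight y s ℚ.+ weight vertex s ℚ.≤ 1ℚ
      compatible = proj₂ (proj₂ (proj₂ (proj₂ binned)))
      C≤C′ : C ≤ cost A L′
      C≤C′ = cost-copies A N vertex (L S)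
      -- A recorded colour would have a witness placed in bin `b`, forcing `b` below `C`.
      P-empty : ∀ b → C ≤ b → filled (P S b) ≡ 0
      P-empty b C≤b with filled (P S b) in eq
      ... | zero  = refl
      ... | suc _ =
        let i , v , Pᵢ≡v = filled>0 (P S b) (≤-trans (s≤s z≤n) (≤-reflexive (sym eq)))
            y , s , placed , _ = witness S b i v Pᵢ≡v
        in contradiction C≤b (<⇒≱ (placed<cost A placed))
      agrees : ∀ {b} → b ∈ bs → ∀ i v → Vec.lookup (P S b) i ≡ just v → Vec.lookup x i ≡ v
      agrees {b} b∈bs i v Pᵢ≡v with Vec.lookup x i Bool.≟ v
      ... | yes eq = eq
      -- With a contradicting label, the witness and the new vertex would together load coordinate
      -- `s` with `1 + ε`.
      ... | no ≢v = contradiction (ℚₚ.<-≤-trans 1<1+ε 1+ε≤1) (ℚₚ.<-irrefl refl)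
        where
        wit = witness S b i v Pᵢ≡v
        y = proj₁ wit
        s = proj₁ (proj₂ wit)
        s-colour = proj₂ (proj₂ (proj₂ (proj₂ wit)))
        weight-s : weight vertex s ≡ ε
        weight-s = trans (weight-≢ (coloured≢τ s-colour)) (trans (cong (conflict x) s-colour)
          (cong (if_then 0ℚ else ε) (dec-false (Vec.lookup x i Bool.≟ v) ≢v)))
        1+ε≤1 : 1ℚ ℚ.+ ε ℚ.≤ 1ℚ
        1+ε≤1 = subst₂ (λ u w → u ℚ.+ w ℚ.≤ 1ℚ) (proj₁ (proj₂ (proj₂ (proj₂ wit)))) weight-s
          (compatible b∈bs (proj₁ (proj₂ (proj₂ wit))) s)
        1<1+ε : 1ℚ ℚ.< 1ℚ ℚ.+ ε
        1<1+ε = subst (ℚ._< 1ℚ ℚ.+ ε) (ℚₚ.+-identityʳ 1ℚ) (ℚₚ.+-monoʳ-< 1ℚ 0<ε)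
      gained = Step.Φ-step ℓ C≤C′ (P S) x P-empty (proj₂ chosen) bs bs!
        (All.map (placed<cost A) bs-placed) agrees
      i : Fin m
      i = proj₁ gained
      c : Colour
      c = i , Vec.lookup x i
      P′ : ℕ → Partial m
      P′ = record-colour bs x i (P S)
      potential′ : suc t * (D * N) ≤ 2 * D * Φ h (cost A L′) P′ + suc t * cost A L′
      potential′ = begin
        D * N + t * (D * N)
          ≤⟨ +-mono-≤ (≤-reflexive (cong (D *_) (sym bs-length))) (potential S) ⟩
        D * length bs + (2 * D * Φ h C (P S) + t * C)
          ≡⟨ +-assoc (D * length bs) _ _ ⟨
        D * length bs + 2 * D * Φ h C (P S) + t * C
          ≤⟨ +-mono-≤ (proj₂ gained) (*-monoʳ-≤ t C≤C′) ⟩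
        2 * D * Φ h (cost A L′) P′ + C + t * cost A L′
          ≡⟨ +-assoc (2 * D * Φ h (cost A L′) P′) C _ ⟩
        2 * D * Φ h (cost A L′) P′ + (C + t * cost A L′)
          ≤⟨ +-monoʳ-≤ (2 * D * Φ h (cost A L′) P′) (+-monoˡ-≤ _ C≤C′) ⟩
        2 * D * Φ h (cost A L′) P′ + suc t * cost A L′ ∎
        where open ≤-Reasoning
      uncoloured′ : ∀ s → suc t ≤ toℕ s → paint i s ≡ nothing
      uncoloured′ s t<s = trans (paint-≢ i s≢τ) (uncoloured S s (<⇒≤ t<s))
        where
        s≢τ : s ≢ τ
        s≢τ refl = <-irrefl (sym toℕ-τ) t<s
      old-witness : ∀ b j v → Vec.lookup (P S b) j ≡ just v → ∃₂ λ y s →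
        Placed A L′ y b × weight y s ≡ 1ℚ × paint i s ≡ just (j , v)
      old-witness b j v Pⱼ≡v = let y , s , placed , y-weight , s-colour = witness S b j v Pⱼ≡v in
        y , s , placed-copies A N placed , y-weight ,
        trans (paint-≢ i (coloured≢τ s-colour)) s-colour
      witness′ : ∀ b j v → Vec.lookup (P′ b) j ≡ just v → ∃₂ λ y s →
        Placed A L′ y b × weight y s ≡ 1ℚ × paint i s ≡ just (j , v)
      witness′ b j v eq = [ old-witness b j v , new-witness ]′
        (lookup-record-colour bs x i (P S) b j eq)
        where
        new-witness : b ∈ bs × j ≡ i × Vec.lookup x i ≡ v → ∃₂ λ y s →
          Placed A L′ y b × weight y s ≡ 1ℚ × paint i s ≡ just (j , v)
        new-witness (b∈bs , j≡i , xᵢ≡v) = vertex , τ , All.lookup bs-placed b∈bs , weight-τ ,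
          trans (paint-τ i) (cong just (cong₂ _,_ (sym j≡i) xᵢ≡v))
      slot′ : Fin (length L′) → Colour × ℕ
      slot′ = assign-copies _≟C_ N c (slot S)
      old new : Colour × ℕ → Fin d → ℚ
      old = loadOf (_≟S_ _≟C_) (L S) (slot S)
      new = loadOf (_≟S_ _≟C_) L′ slot′
      new≤ : ∀ b s → new b s ℚ.≤ old b s ℚ.+ weight vertex s
      new≤ b s = load-copies _≟C_ c (slot S) s N b
      unchanged : ∀ b s → c ≢ proj₁ b → new b s ≡ old b s
      unchanged b s c≢ = load-copies-unchanged _≟C_ c (slot S) s N λ _ eq → c≢ (cong proj₁ eq)
      load-uncoloured′ : ∀ b s → paint i s ≡ nothing → new b s ℚ.≤ 0ℚ
      load-uncoloured′ b s eq = ℚₚ.≤-trans (new≤ b s) (ℚₚ.+-mono-≤ (load-uncoloured S b s s-colour)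
        (ℚₚ.≤-reflexive (trans (weight-≢ s≢τ) (cong (conflict x) s-colour))))
        where
        s≢τ : s ≢ τ
        s≢τ refl = contradiction (trans (sym eq) (paint-τ i)) λ ()
        s-colour = trans (sym (paint-≢ i s≢τ)) eq
      load-coloured′ : ∀ b s c′ → paint i s ≡ just c′ →
        (c′ ≡ proj₁ b × new b s ℚ.≤ 1ℚ) ⊎ new b s ℚ.≤ ℕ→ℚ (suc t) ℚ.* ε
      load-coloured′ b s c′ eq = by-vertex (s Fin.≟ τ)
        where
        Bound : Set
        Bound = (c′ ≡ proj₁ b × new b s ℚ.≤ 1ℚ) ⊎ new b s ℚ.≤ ℕ→ℚ (suc t) ℚ.* ε
        -- Coordinate `τ` was uncoloured, so its old load is at most 0 and any new load comes from a
        -- single copy of the vertex.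
        at-τ : s ≡ τ → Dec (c ≡ proj₁ b) → Bound
        at-τ refl (yes c≡) = inj₁ (trans (just-injective (trans (sym eq) (paint-τ i))) c≡ ,
          ℚₚ.≤-trans (new≤ b τ)
            (ℚₚ.+-mono-≤ (load-uncoloured S b τ colour-τ) (ℚₚ.≤-reflexive weight-τ)))
        at-τ refl (no c≢) = inj₂ (ℚₚ.≤-trans (ℚₚ.≤-reflexive (unchanged b τ c≢))
          (ℚₚ.≤-trans (load-uncoloured S b τ colour-τ)
            (ℚₚ.≤-trans (ℚₚ.≤-reflexive (sym (ℚₚ.*-zeroˡ ε))) (*ε-mono {0} {suc t} z≤n))))
        same-colour : s ≢ τ → colour S s ≡ just c′ → c′ ≡ proj₁ b → old b s ℚ.≤ 1ℚ →
          Dec (c ≡ proj₁ b) → new b s ℚ.≤ 1ℚ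
        same-colour s≢τ s-colour c′≡ old≤1 (no c≢) =
          ℚₚ.≤-trans (ℚₚ.≤-reflexive (unchanged b s c≢)) old≤1
        same-colour s≢τ s-colour c′≡ old≤1 (yes c≡) =
          ℚₚ.≤-trans (new≤ b s) (ℚₚ.+-mono-≤ old≤1 (ℚₚ.≤-reflexive no-conflict))
          where
          -- The colour of the new vertex is read off its own label, so it cannot contradict an
          -- equal colour.
          no-conflict : weight vertex s ≡ 0ℚ
          no-conflict = trans (weight-≢ s≢τ) (trans
            (cong (conflict x) (trans s-colour (cong just (trans c′≡ (sym c≡)))))
            (conflict-self x i))
        elsewhere : s ≢ τ → colour S s ≡ just c′ →
          (c′ ≡ proj₁ b × old b s ℚ.≤ 1ℚ) ⊎ old b s ℚ.≤ ℕ→ℚ t ℚ.* ε → Bound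
        elsewhere s≢τ s-colour (inj₁ (c′≡ , old≤1)) =
          inj₁ (c′≡ , same-colour s≢τ s-colour c′≡ old≤1 (c ≟C proj₁ b))
        elsewhere s≢τ s-colour (inj₂ old≤tε) = inj₂ (ℚₚ.≤-trans (new≤ b s) (ℚₚ.≤-trans
          (ℚₚ.+-mono-≤ old≤tε
            (ℚₚ.≤-trans (ℚₚ.≤-reflexive (weight-≢ s≢τ)) (conflict≤ε x (colour S s))))
          (ℚₚ.≤-reflexive (*ε-suc t))))
        by-vertex : Dec (s ≡ τ) → Bound
        by-vertex (yes s≡τ) = at-τ s≡τ (c ≟C proj₁ b)
        by-vertex (no  s≢τ) = elsewhere s≢τ s-colour (load-coloured S b s c′ s-colour)
          where s-colour = trans (sym (paint-≢ i s≢τ)) eq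

    play : ∀ t → t ≤ d → State t
    play zero    _   = start
    play (suc t) t<d = step t<d (play t (<⇒≤ t<d))

    finish : State d
    finish = play d ≤-refl

    -- The bins are `N` copies of each of the `m * 2` colours. Conflicts from all `d` rounds total
    -- at most `d * ε = 1` in a coordinate.
    finish-packable : Packable (L finish) (m * 2 * N)
    finish-packable = (λ j → number (slot finish j) (slot<N finish j)) ,
      feasible-transfer (_≟S_ _≟C_) Fin._≟_ (L finish) (slot finish) _
        (λ j k → number-cong (slot<N finish j) (slot<N finish k))
        (λ j k → number-injective {slot finish j} {slot finish k}
          (slot<N finish j) (slot<N finish k))
        (λ j s → load≤1 (slot finish j) s)
      where
      open Inverse Finₚ.2↔Bool using (to; from; strictlyInverseˡ)
      number : (b : Colour × ℕ) → proj₂ b < N → Fin (m * 2 * N)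
      number ((i , v) , k) k<N = combine (combine i (from v)) (fromℕ< k<N)
      number-cong : ∀ {b b′} (b<N : proj₂ b < N) (b′<N : proj₂ b′ < N) → b ≡ b′ →
        number b b<N ≡ number b′ b′<N
      number-cong b<N b′<N refl = refl
      number-injective : ∀ {b b′} (b<N : proj₂ b < N) (b′<N : proj₂ b′ < N) →
        number b b<N ≡ number b′ b′<N → b ≡ b′
      number-injective {(i , v) , k} {(i′ , v′) , k′} k<N k′<N eq
        with Finₚ.combine-injective (combine i _) (fromℕ< k<N) (combine i′ _) (fromℕ< k′<N) eq
      ... | iv≡ , k≡ with Finₚ.combine-injective i _ i′ _ iv≡
      ... | refl , v≡
        with refl ← Finₚ.fromℕ<-injective k k′ k<N k′<N k≡
           | refl ← trans (sym (strictlyInverseˡ v)) (trans (cong to v≡) (strictlyInverseˡ v′))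
        = refl
      load≤1 : ∀ b s → loadOf (_≟S_ _≟C_) (L finish) (slot finish) b s ℚ.≤ 1ℚ
      load≤1 b s with colour finish s in eq
      ... | nothing = ℚₚ.≤-trans (load-uncoloured finish b s eq) (ℚₚ.nonNegative⁻¹ 1ℚ)
      ... | just c with load-coloured finish b s c eq
      ...   | inj₁ (_ , ≤1) = ≤1
      ...   | inj₂ ≤dε = ℚₚ.≤-trans ≤dε (*ε-≤1 ≤-refl)

    -- Each bin contributes at most `h` to the potential, and `d ≤ D` absorbs the accumulated error
    -- `d * C` into `D * C`, so `D` cancels.
    finish-cost : d ≤ D → d * N ≤ (2 * h + 1) * cost A (L finish)
    finish-cost d≤D = *-cancelˡ-≤ D {{m^n≢0 2 h}} (begin
      D * (d * N)                       ≡⟨ x∙yz≈y∙xz D d N ⟩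
      d * (D * N)                       ≤⟨ potential finish ⟩
      2 * D * Φ h C (P finish) + d * C  ≤⟨ +-mono-≤ (*-monoʳ-≤ (2 * D) Φ≤C*h) (*-monoˡ-≤ C d≤D) ⟩
      2 * D * (C * h) + D * C           ≡⟨ collect D C h ⟩
      D * ((2 * h + 1) * C)             ∎)
      where
      open ≤-Reasoning
      C = cost A (L finish)
      Φ≤C*h : Φ h C (P finish) ≤ C * h
      Φ≤C*h = ∑-≤ C λ b → m⊓n≤n (filled (P finish b)) h
      collect : ∀ D C h → 2 * D * (C * h) + D * C ≡ D * ((2 * h + 1) * C)
      collect = solve-∀

  -- Playing with `K` copies of each vertex gives OPT ≥ `K`. The constant combines OPT ≤ 4 h K with
  -- d K ≤ (2 h + 1) times the cost.
  hard-input : ∀ {d ℓ} → 0 < d → d ≤ 2 ^ suc ℓ → (A : OnlineAlgorithm d) → ∀ K →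
    ∃₂ λ L opt → IsOPT L opt × K ≤ opt × d * opt ≤ 4 * suc ℓ * (2 * suc ℓ + 1) * cost A L
  hard-input {d@(suc _)} {ℓ} _ d≤D A K =
    let opt , isOPT , opt≤ = OPT-exists finish-packable in
    L finish , opt , isOPT ,
    subst (K ≤_) (proj₂ (proj₁ isOPT)) (crowded finish (s≤s z≤n) (proj₁ (proj₁ isOPT))) , (begin
      d * opt                        ≤⟨ *-monoʳ-≤ d opt≤ ⟩
      d * (2 * h * 2 * K)            ≡⟨ rearrange d h K ⟩
      4 * h * (d * K)                ≤⟨ *-monoʳ-≤ (4 * h) (finish-cost d≤D) ⟩
      4 * h * ((2 * h + 1) * cost A (L finish)) ≡⟨ *-assoc (4 * h) (2 * h + 1) _ ⟨
      4 * h * (2 * h + 1) * cost A (L finish)   ∎)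
    where
    open Game A K ℓ
    open State
    open ≤-Reasoning
    rearrange : ∀ d h K → d * (2 * h * 2 * K) ≡ 4 * h * (d * K)
    rearrange = solve-∀

open Adversary

-- Choice of parameters and the two bounds

⌊log₂⌋-exists : ∀ d → 0 < d → ∃ λ k → 2 ℕ.^ k ≤ d × d < 2 ℕ.^ suc k
⌊log₂⌋-exists (suc zero)    _ = 0 , s≤s z≤n , s≤s (s≤s z≤n)
⌊log₂⌋-exists (suc (suc d)) _ with ⌊log₂⌋-exists (suc d) (s≤s z≤n)
... | k , 2^k≤d , d<2^1+k with 2 ℕ.^ suc k ℕ.≤? suc (suc d)
...   | yes 2^1+k≤d+1 = suc k , 2^1+k≤d+1 ,
  ≤-<-trans d<2^1+k (^-monoʳ-< 2 (s≤s (s≤s z≤n)) (n<1+n (suc k)))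
...   | no  2^1+k≰d+1 = k , m≤n⇒m≤1+n 2^k≤d , ≰⇒> 2^1+k≰d+1

-- The game is played with `h = suc k`, which guarantees `d ≤ 2 ^ h`, while the target denominator
-- is bounded below through `k ≤ log₂ d`. The numerator `n` covers both `d ∸ 1` and `d`.
lower-bound : ∀ {d n} k c e → 0 < n → n ≤ d → 2 ℕ.^ k ≤ d → d ≤ 2 ℕ.^ suc k →
  4 ℕ.* suc k ℕ.* (2 ℕ.* suc k ℕ.+ 1) ≤ c ℕ.* k ℕ.^ e →
  (A : OnlineAlgorithm d) → asymptoticRatio A ≥ᴿ fromℕ n Defs./ (fromℕ c Defs.* log₂ d Defs.^ e)
lower-bound {d} {n} k c e 0<n n≤d 2^k≤d d≤2^1+k E≥ A {q} q< =
  asymptoticRatio-≥ A n E {{ℕ.>-nonZero (≤-trans (s≤s z≤n) E≥)}} hard {q}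
    (below-/ {fromℕ c Defs.* log₂ d Defs.^ e} {n} {E} 0<n
      (above-* {fromℕ c} {log₂ d Defs.^ e} {c} {k ℕ.^ e} ℚₚ.<⇒≤
        (above-^ {log₂ d} {k} (above-log₂ {d} {k} 2^k≤d) e)) {q} q<)
  where
  E : ℕ
  E = c ℕ.* k ℕ.^ e
  hard : ∀ K → ∃₂ λ L opt → IsOPT L opt × K ≤ opt × n ℕ.* opt ≤ E ℕ.* cost A L
  hard K =
    let L , opt , isOPT , K≤opt , bound = hard-input {ℓ = k} (≤-trans 0<n n≤d) d≤2^1+k A K in
    L , opt , isOPT , K≤opt ,
    ≤-trans (*-monoˡ-≤ opt n≤d) (≤-trans bound (*-monoˡ-≤ (cost A L) E≥))

-- After the substitution `k = 4 + j` the difference of the two sides is a polynomial in `j` with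
-- nonnegative coefficients.
cubic-bound : ∀ k → 4 ≤ k → 4 ℕ.* suc k ℕ.* (2 ℕ.* suc k ℕ.+ 1) ≤ 8 ℕ.* k ℕ.^ 3
cubic-bound k 4≤k = subst (λ k → 4 ℕ.* suc k ℕ.* (2 ℕ.* suc k ℕ.+ 1) ≤ 8 ℕ.* k ℕ.^ 3)
  (m+[n∸m]≡n 4≤k) (≤-trans (m≤m+n _ _) (≤-reflexive (difference (k ∸ 4))))
  where
  difference : ∀ j → 4 ℕ.* suc (4 ℕ.+ j) ℕ.* (2 ℕ.* suc (4 ℕ.+ j) ℕ.+ 1)
    ℕ.+ (292 ℕ.+ 300 ℕ.* j ℕ.+ 88 ℕ.* (j ℕ.* j) ℕ.+ 8 ℕ.* (j ℕ.* j ℕ.* j))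
    ≡ 8 ℕ.* ((4 ℕ.+ j) ℕ.* ((4 ℕ.+ j) ℕ.* ((4 ℕ.+ j) ℕ.* 1)))
  difference = solve-∀

-- The constant 40 already suffices, with equality at `k` = 1; the rest of 2 ^ 11 = 40 + 2008 is
-- slack.
quadratic-bound : ∀ k → 1 ≤ k → 4 ℕ.* suc k ℕ.* (2 ℕ.* suc k ℕ.+ 1) ≤ 2 ℕ.^ 11 ℕ.* k ℕ.^ 2
quadratic-bound (suc j) _ = ≤-trans (m≤m+n _ (44 ℕ.* j ℕ.+ 32 ℕ.* (j ℕ.* j)))
  (≤-trans (≤-reflexive (difference j)) (*-monoˡ-≤ (suc j ℕ.^ 2) (m≤m+n 40 2008)))
  where
  difference : ∀ j → 4 ℕ.* suc (suc j) ℕ.* (2 ℕ.* suc (suc j) ℕ.+ 1)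
    ℕ.+ (44 ℕ.* j ℕ.+ 32 ℕ.* (j ℕ.* j)) ≡ 40 ℕ.* (suc j ℕ.* (suc j ℕ.* 1))
  difference = solve-∀

open import Defs

theorem4 :
    (∀ d → 16 < d → (A : OnlineAlgorithm d) →
      asymptoticRatio A ≥ᴿ fromℕ (d ∸ 1) / (fromℕ 8 * log₂ d ^ 3))
    × (∃ λ (d₀ : ℕ) → ∀ d → d₀ ≤ d → (A : OnlineAlgorithm d) →
      asymptoticRatio A ≥ᴿ fromℕ d / (fromℕ (2 ℕ.^ 11) * log₂ d ^ 2))
-- The threshold 2 makes the integer part of `log₂ d` at least 1, as `quadratic-bound` requires.
theorem4 = cubic , 2 , quadratic
  where
  cubic : ∀ d → 16 < d → (A : OnlineAlgorithm d) →
    asymptoticRatio A ≥ᴿ fromℕ (d ∸ 1) / (fromℕ 8 * log₂ d ^ 3)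
  cubic d@(suc d-1) 16<d A =
    let k , 2^k≤d , d<2^1+k = ⌊log₂⌋-exists d (s≤s z≤n)
        -- If `k` < 4, then `d` < 2 ^ (k + 1) ≤ 16.
        4≤k = ≮⇒≥ λ k<4 → <⇒≱ (<-trans 16<d d<2^1+k) (^-monoʳ-≤ 2 k<4)
    in lower-bound k 8 3 (≤-trans (s≤s z≤n) (ℕ.s≤s⁻¹ 16<d)) (n≤1+n d-1)
         2^k≤d (<⇒≤ d<2^1+k) (cubic-bound k 4≤k) A
  quadratic : ∀ d → 2 ≤ d → (A : OnlineAlgorithm d) →
    asymptoticRatio A ≥ᴿ fromℕ d / (fromℕ (2 ℕ.^ 11) * log₂ d ^ 2)
  quadratic d 2≤d A =
    let 0<d = ≤-trans (s≤s z≤n) 2≤d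
        k , 2^k≤d , d<2^1+k = ⌊log₂⌋-exists d 0<d
        1≤k = ≮⇒≥ λ k<1 → <⇒≱ (≤-<-trans 2≤d d<2^1+k) (^-monoʳ-≤ 2 k<1)
    in lower-bound k (2 ℕ.^ 11) 2 0<d ≤-refl 2^k≤d (<⇒≤ d<2^1+k) (quadratic-bound k 1≤k) A
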